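{- The model-checking problem for Strategy Logic with imperfect information (SL_i) restricted to the class of hierarchical instances is decidable.
   Context: SL_i (Strategy Logic with imperfect information) has formulas φ ::= p | ¬φ | φ∨φ | Xφ | φUφ | ∃^o x.φ | (a,x)φ, where p is an atomic proposition, x a strategy variable, a an agent, and o an observation symbol. Models are concurrent game structures with imperfect information (CGS_i) G = (Act, V, E, ℓ, v_ι, O): actions Act, positions V, transition function E : V × Act^Agents → V, labelling ℓ, initial position v_ι, and O mapping each observation symbol o to an equivalence relation ~_o on positions. Players have synchronous perfect recall: ~_o is lifted to finite plays of equal length pointwise, and an o-strategy is a map from finite plays to actions taking equal values on ~_o-equivalent plays; ∃^o x.φ quantifies over o-strategies, (a,x) binds agent a to the strategy of x. An SL_i-instance is a pair (Φ, G); the model-checking problem asks whether G ⊨ Φ. An instance (Φ, G) is hierarchical if for all subformulas φ_2 = ∃^{o_2}x.φ_2' and φ_1 = ∃^{o_1}y.φ_1' of Φ with φ_1 a subformula of φ_2', we have O(o_1) ⊆ O(o_2) (i.e. inner quantifiers observe at least as finely as outer ones). -}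

module Defs where

open import Axiom.ExcludedMiddle using (ExcludedMiddle)
open import Data.Bool using (Bool; true; T; if_then_else_)
open import Data.Fin using (Fin)
open import Data.Fin.Subset using (Subset; Empty; ⊥; ⊤; ⁅_⁆; _∪_; _-_)
open import Data.Maybe using (Maybe; just; nothing; Is-just; to-witness)
open import Data.Nat using (ℕ; zero; suc; _<_)
open import Data.Product using (_×_; _,_; ∃-syntax; Σ-syntax)
open import Data.Sum using (_⊎_)
open import Data.Vec using (Vec; lookup; replicate; tabulate; _[_]≔_)
open import Function.Bundles using (_⇔_)
open import Level using (0ℓ)
open import Relation.Binary using (IsEquivalence)
open import Relation.Binary.PropositionalEquality using (_≡_; refl)
open import Relation.Nullary using (¬_)

-- Atomic propositions, agents, strategy variables and observation symbols
-- range over finite sets, which are part of the input.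
record Signature : Set where
  field
    nAP nAg nVar nObs : ℕ

  AP Agent Var Obs : Set
  AP    = Fin nAP
  Agent = Fin nAg
  Var   = Fin nVar
  Obs   = Fin nObs

module Syntax (S : Signature) where
  open Signature S

  infixr 6 _∨′_
  infixr 7 _U′_

  data Formula : Set where
    atom     : AP → Formula
    ¬′_      : Formula → Formula
    _∨′_     : Formula → Formula → Formula
    X′_      : Formula → Formula
    _U′_     : Formula → Formula → Formula
    ∃′[_]_∙_ : Obs → Var → Formula → Formula
    ⟨_,_⟩_   : Agent → Var → Formula → Formula

  -- free(φ) ⊆ Agents ∪ Var is split into its agents and its variables.
  -- All agents are free in a temporal formula, since its evaluation needs a
  -- strategy for every agent.
  freeAgents : Formula → Subset nAg
  freeAgents (atom p)       = ⊥
  freeAgents (¬′ φ)         = freeAgents φ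
  freeAgents (φ ∨′ ψ)       = freeAgents φ ∪ freeAgents ψ
  freeAgents (X′ φ)         = ⊤
  freeAgents (φ U′ ψ)       = ⊤
  freeAgents (∃′[ o ] x ∙ φ) = freeAgents φ
  freeAgents (⟨ a , x ⟩ φ)  = freeAgents φ - a

  -- Binding a to x uses x only if a is free in the scope of the binding.
  freeVars : Formula → Subset nVar
  freeVars (atom p)       = ⊥
  freeVars (¬′ φ)         = freeVars φ
  freeVars (φ ∨′ ψ)       = freeVars φ ∪ freeVars ψ
  freeVars (X′ φ)         = freeVars φ
  freeVars (φ U′ ψ)       = freeVars φ ∪ freeVars ψ
  freeVars (∃′[ o ] x ∙ φ) = freeVars φ - x
  freeVars (⟨ a , x ⟩ φ)  =
    if lookup (freeAgents φ) a then freeVars φ ∪ ⁅ x ⁆ else freeVars φ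

  Sentence : Formula → Set
  Sentence φ = Empty (freeAgents φ) × Empty (freeVars φ)

  infix 4 _⊑_

  data _⊑_ (ξ : Formula) : Formula → Set where
    here  : ξ ⊑ ξ
    in-¬  : ∀ {φ}     → ξ ⊑ φ → ξ ⊑ ¬′ φ
    in-∨ˡ : ∀ {φ ψ}   → ξ ⊑ φ → ξ ⊑ φ ∨′ ψ
    in-∨ʳ : ∀ {φ ψ}   → ξ ⊑ ψ → ξ ⊑ φ ∨′ ψ
    in-X  : ∀ {φ}     → ξ ⊑ φ → ξ ⊑ X′ φ
    in-Uˡ : ∀ {φ ψ}   → ξ ⊑ φ → ξ ⊑ φ U′ ψ
    in-Uʳ : ∀ {φ ψ}   → ξ ⊑ ψ → ξ ⊑ φ U′ ψ
    in-∃  : ∀ {o x φ} → ξ ⊑ φ → ξ ⊑ ∃′[ o ] x ∙ φ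
    in-⟨⟩ : ∀ {a x φ} → ξ ⊑ φ → ξ ⊑ ⟨ a , x ⟩ φ

-- Concurrent game structures with imperfect information.  Observation
-- relations and labels are Boolean tables, so that a structure is finite data.
record CGSi (S : Signature) : Set where
  open Signature S
  field
    nAct nPos : ℕ

  Action : Set
  Action = Fin nAct

  Position : Set
  Position = Fin nPos

  field
    E             : Position → Vec Action nAg → Position
    ℓ             : Position → AP → Bool
    vι            : Position
    O             : Obs → Position → Position → Bool
    O-equivalence : ∀ o → IsEquivalence (λ u v → T (O o u v))

module Plays {S : Signature} (G : CGSi S) where
  open Signature S
  open CGSi G

  infix 4 _⟶_ _∼[_]_

  _⟶_ : Position → Position → Set
  u ⟶ v = ∃[ α ] E u α ≡ v

  -- A finite play is a word of positions that starts in vι and follows _⟶_.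
  -- The edge proofs are irrelevant: a play does not record the joint actions.
  data FinPlay : Set
  last : FinPlay → Position

  data FinPlay where
    init   : FinPlay
    extend : (ρ : FinPlay) (v : Position) → .(last ρ ⟶ v) → FinPlay

  last init           = vι
  last (extend ρ v _) = v

  -- The pointwise lifting of O o to plays of equal length; the first
  -- positions of any two plays coincide.
  data _∼[_]_ : FinPlay → Obs → FinPlay → Set where
    init   : ∀ {o} → init ∼[ o ] init
    extend : ∀ {o ρ ρ′ v v′} .{e : last ρ ⟶ v} .{e′ : last ρ′ ⟶ v′} →
             ρ ∼[ o ] ρ′ → T (O o v v′) → extend ρ v e ∼[ o ] extend ρ′ v′ e′

  Strategy : Set
  Strategy = FinPlay → Action

  Uniform : Obs → Strategy → Set
  Uniform o σ = ∀ {ρ ρ′} → ρ ∼[ o ] ρ′ → σ ρ ≡ σ ρ′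

  -- Partial functions from agents and variables to strategies.
  record Assignment : Set where
    constructor _∣_
    field
      agents : Vec (Maybe Strategy) nAg
      vars   : Vec (Maybe Strategy) nVar
  open Assignment public

  ∅ : Assignment
  ∅ = replicate nAg nothing ∣ replicate nVar nothing

  _[var_↦_] : Assignment → Var → Strategy → Assignment
  χ [var x ↦ σ ] = agents χ ∣ (vars χ [ x ]≔ just σ)

  _[agent_↦var_] : Assignment → Agent → Var → Assignment
  χ [agent a ↦var x ] = (agents χ [ a ]≔ lookup (vars χ) x) ∣ vars χ

  Complete : Assignment → Set
  Complete χ = ∀ a → Is-just (lookup (agents χ) a)

  jointAction : ∀ χ → Complete χ → FinPlay → Vec Action nAg
  jointAction χ c ρ = tabulate λ a → to-witness (c a) ρ

  -- The prefix of the outcome of χ from ρ that extends ρ by i positions.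
  out : ∀ χ → Complete χ → FinPlay → ℕ → FinPlay
  out χ c ρ zero    = ρ
  out χ c ρ (suc i) = extend ρᵢ (E (last ρᵢ) α) (α , refl)
    where
    ρᵢ = out χ c ρ i
    α  = jointAction χ c ρᵢ

module Semantics {S : Signature} (G : CGSi S) where
  open Signature S
  open CGSi G
  open Plays G
  open Syntax S

  infix 3 _,_⊨_

  -- Outcomes exist only for assignments that are defined on all agents.  For
  -- sentences evaluated from ∅, temporal formulas only meet such assignments.
  _,_⊨_ : Assignment → FinPlay → Formula → Set
  χ , ρ ⊨ atom p        = T (ℓ (last ρ) p)
  χ , ρ ⊨ ¬′ φ          = ¬ (χ , ρ ⊨ φ)
  χ , ρ ⊨ φ ∨′ ψ        = (χ , ρ ⊨ φ) ⊎ (χ , ρ ⊨ ψ)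
  χ , ρ ⊨ X′ φ          = ∃[ c ] (χ , out χ c ρ 1 ⊨ φ)
  χ , ρ ⊨ φ U′ ψ        = ∃[ c ] ∃[ i ] (χ , out χ c ρ i ⊨ ψ) ×
                            (∀ j → j < i → χ , out χ c ρ j ⊨ φ)
  χ , ρ ⊨ ∃′[ o ] x ∙ φ = ∃[ σ ] Uniform o σ × (χ [var x ↦ σ ] , ρ ⊨ φ)
  χ , ρ ⊨ ⟨ a , x ⟩ φ   = χ [agent a ↦var x ] , ρ ⊨ φ

record Instance : Set where
  field
    S : Signature
  open Syntax S
  field
    Φ        : Formula
    sentence : Sentence Φ
    G        : CGSi S

Holds : Instance → Set
Holds I = ∅ , init ⊨ Φ
  where
  open Instance I
  open Plays G
  open Semantics G

Hierarchical : Instance → Set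
Hierarchical I =
  ∀ {o₁ o₂ x y φ₁ φ₂} →
  (∃′[ o₂ ] x ∙ φ₂) ⊑ Φ → (∃′[ o₁ ] y ∙ φ₁) ⊑ φ₂ →
  ∀ u v → T (O o₁ u v) → T (O o₂ u v)
  where
  open Instance I
  open Syntax S
  open CGSi G

-- Decidability of the promise problem "given x with P x, does Q x hold?".
-- The decision procedure is a constructive function, hence computable: it must
-- be given without any classical axiom.  Its correctness may be proved in
-- classical mathematics: Q is read classically, as its constructive reading
-- would change the meaning of disjunction and of strategy quantification.
DecidableOn : {A : Set} → (A → Set) → (A → Set) → Set₁
DecidableOn {A} P Q =
  Σ[ decide ∈ (A → Bool) ]
    (ExcludedMiddle 0ℓ → ∀ x → P x → decide x ≡ true ⇔ Q x)

{-# OPTIONS --safe #-}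
module Submission where

-- The strategies in scope at a subformula are read off a labelled tree of
-- positions, and each formula φ is translated into an alternating parity tree
-- automaton that accepts at a node iff φ holds there.  Boolean and temporal
-- connectives are local; negation is dualisation, by positional determinacy of
-- parity games.  For ∃^o x, all labels in scope are o-uniform because the
-- instance is hierarchical, so the automaton may be run along representatives
-- of the o-classes of directions only.  There it is simulated by one that
-- guesses the actions of x together with a positional strategy and checks all
-- traces with a deterministic automaton, which makes projection onto the other
-- labels sound.  For a sentence the tree carries no information, and acceptance
-- becomes a parity game on the finitely many states.

-- The decision procedure must be axiom-free while its correctness may be classical, so automata are
-- finite data, and acceptance, the existence of a positional winning strategy, is reasoned about
-- under excluded middle only. Comparing two arenas then relies on determinacy, since a simulation
-- by itself yields a strategy with memory. Quantification is the hard step: copies of an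
-- alternating automaton at the same node could guess different actions. With the positional
-- strategy guessed as well, all copies are tracked by one deterministic automaton whose state is a
-- function of the path read, which leaves a single action per address. Reading paths through
-- representatives makes this action equal on indistinguishable addresses, but it is faithful only
-- if the labels in scope are uniform too. An outer strategy, uniform for a coarser observation, is
-- uniform for a finer inner one; this is what the hierarchy grants. Determinisation works with the
-- finite semigroup of trace tables of word segments. The same deterministic automaton also solves
-- the final finite game.

open import Data.Bool using (Bool; true; false; T; not; if_then_else_)
open import Data.Bool.Properties using (T?; T-not-≡; not-involutive)
open import Data.Empty using (⊥; ⊥-elim)
open import Data.Fin using (Fin; zero; suc; toℕ; inject≤; combine; remQuot; join; splitAt)
import Data.Fin as Fin using (_<_)
import Data.Fin.Properties as Fin
open import Data.List using (List; []; _∷_; _++_; map; take; length)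
open import Data.List.Properties using (length-++)
open import Data.List.Relation.Binary.Pointwise using (Pointwise; []; _∷_; Pointwise-length; ++⁺)
import Data.List.Relation.Binary.Pointwise as Pointwise
open import Data.Maybe using (Maybe; just; nothing; Is-just; to-witness; fromMaybe)
import Data.Maybe as Maybe
open import Data.Maybe.Properties using (just-injective)
open import Data.Maybe.Relation.Unary.Any using (just)
open import Data.Nat hiding (_≟_)
open import Data.Nat.DivMod using (m≡m%n+[m/n]*n; m%n<n; [m+kn]%n≡m%n; m<n⇒m%n≡m)
open import Data.Nat.Induction using (<-wellFounded)
open import Data.Nat.Properties hiding (_≟_)
import Data.Nat.Properties as ℕ using (_≟_)
open import Data.Product using (_×_; _,_; proj₁; proj₂; ∃-syntax; Σ-syntax; map₁)
open import Data.Sum using (_⊎_; inj₁; inj₂)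
open import Data.Unit using (⊤; tt)
open import Data.Vec using (Vec; []; _∷_; lookup; tabulate; _[_]≔_; replicate)
import Data.Vec as Vec
open import Data.Vec.Properties using (lookup∘tabulate; lookup-map; map-[]≔; map-replicate)
open import Defs
open import Function using (_∘_; id)
open import Function.Bundles using (_⇔_; mk⇔; Equivalence)
import Induction.WellFounded as WF
open import Relation.Binary using (IsEquivalence)
open import Relation.Binary.PropositionalEquality
open import Relation.Nullary using (¬_; Dec; yes; no; does)
open import Relation.Nullary.Decidable using (map′; _×-dec_; toWitness; fromWitness; ⌊_⌋)

-- Parity games

even : ℕ → Bool
even zero    = true
even (suc n) = not (even n)

Infinitely Eventually : (ℕ → Set) → Set
Infinitely P = ∀ N → ∃[ n ] N ≤ n × P n
Eventually P = ∃[ N ] ∀ n → N ≤ n → P n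

-- The min-parity condition: `k` is the least value taken infinitely often. The Boolean names the
-- winner, so that one definition serves both sides.
Parity : Bool → (ℕ → ℕ) → Set
Parity b a = ∃[ k ] even k ≡ b × Eventually (λ n → k ≤ a n) × Infinitely (λ n → a n ≡ k)

parity-unique : ∀ {b b′ a} → Parity b a → Parity b′ a → b ≡ b′
parity-unique {a = a} (k , refl , (N , k≤) , inf) (k′ , refl , (N′ , k′≤) , inf′)
  with inf N′ | inf′ N
... | n , N′≤n , refl | n′ , N≤n′ , refl = cong even (≤-antisym (k≤ n′ N≤n′) (k′≤ n N′≤n))

parity-exclusive : ∀ {a} → Parity true a → ¬ Parity false a
parity-exclusive p q with () ← parity-unique p q

parity-cong : ∀ {b a a′} → (∀ n → a n ≡ a′ n) → Parity b a → Parity b a′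
parity-cong eq (k , e , (N , k≤) , inf) =
  k , e , (N , λ n N≤n → subst (k ≤_) (eq n) (k≤ n N≤n)) ,
  λ M → let n , M≤n , an≡k = inf M in n , M≤n , trans (sym (eq n)) an≡k

parity-drop : ∀ {b a} m → Parity b a → Parity b (λ n → a (m + n))
parity-drop {b} {a} m (k , e , (N , k≤) , inf) =
  k , e , (N , λ n N≤n → k≤ (m + n) (≤-trans N≤n (m≤n+m n m))) , inf′
  where
  inf′ : Infinitely (λ n → a (m + n) ≡ k)
  inf′ M with inf (m + M)
  ... | n , m+M≤n , an≡k =
    n ∸ m , subst (_≤ n ∸ m) (m+n∸m≡n m M) (∸-monoˡ-≤ m m+M≤n) ,
    trans (cong a (m+[n∸m]≡n (≤-trans (m≤m+n m M) m+M≤n))) an≡k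

parity-undrop : ∀ {b a} m → Parity b (λ n → a (m + n)) → Parity b a
parity-undrop {b} {a} m (k , e , (N , k≤) , inf) =
  k , e ,
  (m + N , λ n m+N≤n →
    let m≤n = ≤-trans (m≤m+n m N) m+N≤n in
    subst (λ j → k ≤ a j) (m+[n∸m]≡n m≤n)
      (k≤ (n ∸ m) (subst (_≤ n ∸ m) (m+n∸m≡n m N) (∸-monoˡ-≤ m m+N≤n)))) ,
  λ M → let n , M≤n , eq = inf M in m + n , ≤-trans M≤n (m≤n+m n m) , eq

parity-suc : ∀ {b a} → Parity b a → Parity (not b) (suc ∘ a)
parity-suc (k , refl , (N , k≤) , inf) =
  suc k , refl , (N , λ n N≤n → s≤s (k≤ n N≤n)) ,
  λ M → let n , M≤n , eq = inf M in n , M≤n , cong suc eq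

parity-pred : ∀ {b a} → Parity b (suc ∘ a) → Parity (not b) a
parity-pred {b} (zero , e , (N , k≤) , inf) with () ← inf 0 .proj₂ .proj₂
parity-pred {b} (suc k , refl , (N , k≤) , inf) =
  k , not-not (even k) , (N , λ n N≤n → s≤s⁻¹ (k≤ n N≤n)) ,
  λ M → let n , M≤n , eq = inf M in n , M≤n , suc-injective eq
  where
  not-not : ∀ x → x ≡ not (not x)
  not-not true  = refl
  not-not false = refl

parity-const : ∀ {a k} → (∀ n → a n ≡ k) → Parity (even k) a
parity-const {a} {k} eq =
  k , refl , (0 , λ n _ → ≤-reflexive (sym (eq n))) , λ M → M , ≤-refl , eq M

module Logic (em : ∀ {P : Set} → Dec P) where

  dne : {P : Set} → ¬ ¬ P → P
  dne {P} ¬¬p with em {P}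
  ... | yes p = p
  ... | no ¬p = ⊥-elim (¬¬p ¬p)

  ¬∀⇒∃¬ : {A : Set} {P : A → Set} → ¬ (∀ a → P a) → ∃[ a ] ¬ P a
  ¬∀⇒∃¬ ¬∀ = dne λ ¬∃ → ¬∀ λ a → dne λ ¬p → ¬∃ (a , ¬p)

  ¬infinitely : {P : ℕ → Set} → ¬ Infinitely P → Eventually (¬_ ∘ P)
  ¬infinitely ¬inf =
    let N , ¬later = ¬∀⇒∃¬ ¬inf in N , λ n N≤n p → ¬later (n , N≤n , p)

  Least : (ℕ → Set) → Set
  Least P = ∃[ n ] P n × (∀ m → m < n → ¬ P m)

  least : {P : ℕ → Set} → ∃[ n ] P n → Least P
  least {P} (n , p) = go n (<-wellFounded n) p
    where
    go : ∀ n → WF.Acc _<_ n → P n → Least P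
    go n (WF.acc rs) p with em {∃[ m ] m < n × P m}
    ... | yes (m , m<n , pm) = go m (rs m<n) pm
    ... | no ¬m              = n , p , λ m m<n pm → ¬m (m , m<n , pm)

  least-unique : {P : ℕ → Set} (x y : Least P) → proj₁ x ≡ proj₁ y
  least-unique (m , pm , <m) (n , pn , <n) =
    ≤-antisym (≮⇒≥ λ n<m → <m n n<m pn) (≮⇒≥ λ m<n → <n m m<n pm)

  antitone-stabilises : (f : ℕ → ℕ) → (∀ n → f (suc n) ≤ f n) →
                        ∃[ N ] ∀ n → f (N + n) ≡ f N
  antitone-stabilises f mono with least {λ v → ∃[ m ] f m ≡ v} (f 0 , 0 , refl)
  ... | v , (N , refl) , <v =
    N , λ n → ≤-antisym (down n) (≮⇒≥ λ lt → <v _ lt (_ , refl))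
    where
    down : ∀ n → f (N + n) ≤ f N
    down zero    = ≤-reflexive (cong f (+-identityʳ N))
    down (suc n) = ≤-trans (≤-reflexive (cong f (+-suc N n))) (≤-trans (mono (N + n)) (down n))

  parity-total : ∀ {a K} → (∀ n → a n < K) → Parity true a ⊎ Parity false a
  parity-total {a} {K} a<K = go K 0 (0 , λ _ _ → z≤n) (m≤m+n K 0)
    where
    decide : ∀ b {k} → even k ≡ b → Eventually (λ n → k ≤ a n) →
             Infinitely (λ n → a n ≡ k) → Parity true a ⊎ Parity false a
    decide true  e ev inf = inj₁ (_ , e , ev , inf)
    decide false e ev inf = inj₂ (_ , e , ev , inf)
    -- `k` climbs through the candidates for the least recurring value while `f` counts down; the
    -- invariant `K ≤ f + k` makes running out of fuel contradict the bound.
    go : ∀ f k → Eventually (λ n → k ≤ a n) → K ≤ f + k → Parity true a ⊎ Parity false a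
    go f k ev@(N , k≤) K≤ with em {Infinitely (λ n → a n ≡ k)}
    ... | yes inf = decide (even k) refl ev inf
    go zero    k (N , k≤) K≤ | no _ = ⊥-elim (<-irrefl refl (<-≤-trans (a<K N) (≤-trans K≤ (k≤ N ≤-refl))))
    go (suc f) k (N , k≤) K≤ | no ¬inf =
      let M , ≢k = ¬infinitely ¬inf in
      go f (suc k)
        (N ⊔ M , λ n le → ≤∧≢⇒< (k≤ n (≤-trans (m≤m⊔n N M) le))
                                (λ eq → ≢k n (≤-trans (m≤n⊔m N M) le) (sym eq)))
        (≤-trans K≤ (≤-reflexive (sym (+-suc f k))))

-- All positions share the choice sets `C` and `B`, so there are no dead ends and every play is
-- infinite; `c₀` and `b₀` serve as choices where nothing is at stake.
record Game (X : Set) : Set₁ where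
  field
    C B  : Set
    c₀   : C
    b₀   : B
    next : X → C → B → X
    Ω    : X → ℕ

module _ {X : Set} (G : Game X) where
  open Game G

  Play : (X → C) → (ℕ → X) → Set
  Play s π = ∀ n → ∃[ b ] π (suc n) ≡ next (π n) (s (π n)) b

  Wins : (X → C) → X → Set
  Wins s x = ∀ π → π 0 ≡ x → Play s π → Parity true (Ω ∘ π)

  Win : X → Set
  Win x = ∃[ s ] Wins s x

  Absorbing : X → Set
  Absorbing x = ∀ c b → next x c b ≡ x

  prepend : X → (ℕ → X) → ℕ → X
  prepend x π zero    = x
  prepend x π (suc n) = π n

  wins-step : ∀ s {x} → Wins s x → ∀ b → Wins s (next x (s x) b)
  wins-step s {x} w b π start play =
    parity-drop 1 (w (prepend x π) refl λ { zero → b , start ; (suc n) → play n })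

  wins-tail : ∀ s π m → (∀ n → ∃[ b ] π (suc (m + n)) ≡ next (π (m + n)) (s (π (m + n))) b) →
              Wins s (π m) → Parity true (Ω ∘ π)
  wins-tail s π m play w =
    parity-undrop m (w (λ n → π (m + n)) (cong π (+-identityʳ m)) λ n →
      let b , eq = play n in b , trans (cong π (+-suc m n)) eq)

-- The opponent moves first by committing to a reply to every choice.
dual : ∀ {X} → Game X → Game X
dual G = record
  { C = C → B ; B = C ; c₀ = λ _ → b₀ ; b₀ = c₀
  ; next = λ x f c → next x c (f c) ; Ω = suc ∘ Ω }
  where open Game G

win-exclusive : ∀ {X} (G : Game X) {x} → Win G x → ¬ Win (dual G) x
win-exclusive {X} G {x} (s , w) (τ , w′) =
  parity-exclusive (w π refl λ n → τ (π n) (s (π n)) , refl)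
    (parity-pred (w′ π refl λ n → s (π n) , refl))
  where
  open Game G
  π : ℕ → X
  π zero    = x
  π (suc n) = next (π n) (s (π n)) (τ (π n) (s (π n)))

-- Positional determinacy of parity games on countable arenas

module Determinacy (em : ∀ {P : Set} → Dec P) {X : Set}
                   (code : X → ℕ) (code-injective : ∀ {x y} → code x ≡ code y → x ≡ y) where
  open Logic em

  -- From y, follow the strategy of the origin of least code whose play may reach
  -- y.  That code never increases along a play, so the origin stabilises.
  module Merge (G : Game X) (P : X → Set) (P⇒win : ∀ x → P x → Win G x) where
    open Game G

    strategy : X → X → C
    strategy x with em {P x}
    ... | yes p = proj₁ (P⇒win x p)
    ... | no  _ = λ _ → c₀

    strategy-wins : ∀ x → P x → Wins G (strategy x) x
    strategy-wins x p with em {P x}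
    ... | yes p′ = proj₂ (P⇒win x p′)
    ... | no ¬p  = ⊥-elim (¬p p)

    data Reach (x : X) : X → Set where
      here : Reach x x
      step : ∀ {y} → Reach x y → ∀ b → Reach x (next y (strategy x y) b)

    reach-wins : ∀ {x y} → P x → Reach x y → Wins G (strategy x) y
    reach-wins p here       = strategy-wins _ p
    reach-wins p (step r b) = wins-step G (strategy _) (reach-wins p r) b

    Candidate : X → ℕ → Set
    Candidate y n = ∃[ x ] P x × code x ≡ n × Reach x y

    Best : X → Set
    Best y = Least (Candidate y)

    origin : ∀ {y} → Best y → X
    origin (_ , (x , _) , _) = x

    merged : X → C
    merged y with em {Best y}
    ... | yes b = strategy (origin b) y
    ... | no  _ = c₀

    origin-unique : ∀ {y z} (b : Best y) (b′ : Best z) → proj₁ b ≡ proj₁ b′ → origin b ≡ origin b′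
    origin-unique (_ , (_ , _ , refl , _) , _) (_ , (_ , _ , refl , _) , _) eq = code-injective eq

    merged-best : ∀ {y} (b : Best y) → merged y ≡ strategy (origin b) y
    merged-best {y} b with em {Best y}
    ... | yes b′ = cong (λ x → strategy x y) (origin-unique b′ b (least-unique b′ b))
    ... | no ¬b  = ⊥-elim (¬b b)

    merged-wins : ∀ x → P x → Wins G merged x
    merged-wins x p π refl play = wins-tail G (strategy (origin (best N))) π N tail-play wins-N
      where
      successor : ∀ {y z} → (b : Best y) → ∃[ β ] z ≡ next y (merged y) β → Candidate z (proj₁ b)
      successor {y} b@(n , (x , px , eq , r) , _) (β , refl) =
        x , px , eq , subst (λ c → Reach x (next y c β)) (sym (merged-best b)) (step r β)
      best : ∀ n → Best (π n)
      best zero    = least (code x , x , p , refl , here)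
      best (suc n) = least (proj₁ (best n) , successor (best n) (play n))
      index : ℕ → ℕ
      index n = proj₁ (best n)
      index-mono : ∀ n → index (suc n) ≤ index n
      index-mono n = ≮⇒≥ λ lt → proj₂ (proj₂ (best (suc n))) _ lt (successor (best n) (play n))
      N = antitone-stabilises index index-mono .proj₁
      stable = antitone-stabilises index index-mono .proj₂
      tail-play : ∀ n → ∃[ b ] π (suc (N + n)) ≡ next (π (N + n)) (strategy (origin (best N)) (π (N + n))) b
      tail-play n with play (N + n)
      ... | b , eq = b , trans eq (cong (λ c → next (π (N + n)) c b)
              (trans (merged-best (best (N + n)))
                     (cong (λ x → strategy x (π (N + n))) (origin-unique (best (N + n)) (best N) (stable n)))))
      wins-N : Wins G (strategy (origin (best N))) (π N)
      wins-N = let _ , (_ , px , _ , r) , _ = best N in reach-wins px r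

  merge : (G : Game X) (P : X → Set) → (∀ x → P x → Win G x) → ∃[ s ] ∀ x → P x → Wins G s x
  merge G P w = merged , merged-wins
    where open Merge G P w

  -- Seeing the reply function `f` in advance is no advantage: some choice `c` is such that every
  -- reply `b` is met by an `f` with `κ x f ≡ c` and `f c ≡ b`. Otherwise each `c` has a reply that
  -- avoids this, and the function collecting these replies is refuted at `κ x f`.
  win-undual² : (G : Game X) {x : X} → Win (dual (dual G)) x → Win G x
  win-undual² G {x} (κ , w) = s , λ π eq play → parity-pred (parity-pred (w π eq λ n →
      let b , e = play n ; f , κf , fc = proj₂ (response (π n)) b in
      f , trans e (cong₂ (next (π n)) (sym κf) (trans (sym fc) (cong f (sym κf))))))
    where
    open Game G
    response : ∀ x → ∃[ c ] ∀ b → ∃[ f ] κ x f ≡ c × f c ≡ b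
    response x = dne λ none →
      let avoid : ∀ c → ∃[ b ] ¬ (∃[ f ] κ x f ≡ c × f c ≡ b)
          avoid c = ¬∀⇒∃¬ λ all → none (c , all)
          f = λ c → proj₁ (avoid c)
      in proj₂ (avoid (κ x f)) (f , refl , refl)
    s : X → C
    s x = proj₁ (response x)

  Determined : Game X → Set
  Determined G = ∀ x → Win G x ⊎ Win (dual G) x

  -- Absorbing positions are exempt because the induction freezes the positions of least priority
  -- instead of removing them. The type of positions, and with it `code`, thus stays fixed.
  Within : ℕ → ℕ → Game X → Set
  Within n k G = ∀ x → Absorbing G x ⊎ (k ≤ Ω x × Ω x < k + n)
    where open Game G

  -- Zielonka's induction on the number of priorities that occur outside absorbing
  -- positions; k is the least of them.
  module Step (n k : ℕ) (determined : ∀ G → Within n (suc k) G → Determined G)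
              (k-even : even k ≡ true) (G : Game X) (within : Within (suc n) k G) where
    open Game G

    W : X → Set
    W = Win (dual G)

    τ : X → C → B
    τ = merge (dual G) W (λ _ w → w) .proj₁

    τ-wins : ∀ x → W x → Wins (dual G) τ x
    τ-wins = merge (dual G) W (λ _ w → w) .proj₂

    W-closed : ∀ x → W x → ∀ c → W (next x c (τ x c))
    W-closed x w c = τ , wins-step (dual G) τ (τ-wins x w) c

    Safe : X → Set
    Safe x = ∃[ c ] ∀ b → ¬ W (next x c b)

    -- Stop at the positions of priority k: there the player wins iff she can
    -- avoid W in one round.
    nextₛ : X → C → B → X
    nextₛ x c b with Ω x ℕ.≟ k
    ... | yes _ = x
    ... | no  _ = next x c b

    Ωₛ : X → ℕ
    Ωₛ x with Ω x ℕ.≟ k | em {Safe x}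
    ... | yes _ | yes _ = 0
    ... | yes _ | no  _ = 1
    ... | no  _ | _     = Ω x

    Gₛ : Game X
    Gₛ = record { C = C ; B = B ; c₀ = c₀ ; b₀ = b₀ ; next = nextₛ ; Ω = Ωₛ }

    nextₛ-stop : ∀ {x} → Ω x ≡ k → ∀ c b → nextₛ x c b ≡ x
    nextₛ-stop {x} eq c b with Ω x ℕ.≟ k
    ... | yes _ = refl
    ... | no ≢k = ⊥-elim (≢k eq)

    nextₛ-go : ∀ {x} → Ω x ≢ k → ∀ c b → nextₛ x c b ≡ next x c b
    nextₛ-go {x} ≢k c b with Ω x ℕ.≟ k
    ... | yes eq = ⊥-elim (≢k eq)
    ... | no _   = refl

    Ωₛ-go : ∀ {x} → Ω x ≢ k → Ωₛ x ≡ Ω x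
    Ωₛ-go {x} ≢k with Ω x ℕ.≟ k | em {Safe x}
    ... | yes eq | _ = ⊥-elim (≢k eq)
    ... | no _   | _ = refl

    Ωₛ-safe : ∀ {x} → Ω x ≡ k → Safe x → Ωₛ x ≡ 0
    Ωₛ-safe {x} eq safe with Ω x ℕ.≟ k | em {Safe x}
    ... | yes _ | yes _    = refl
    ... | yes _ | no unsafe = ⊥-elim (unsafe safe)
    ... | no ≢k | _        = ⊥-elim (≢k eq)

    Ωₛ-unsafe : ∀ {x} → Ω x ≡ k → ¬ Safe x → Ωₛ x ≡ 1
    Ωₛ-unsafe {x} eq unsafe with Ω x ℕ.≟ k | em {Safe x}
    ... | yes _ | yes safe = ⊥-elim (unsafe safe)
    ... | yes _ | no _     = refl
    ... | no ≢k | _        = ⊥-elim (≢k eq)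

    withinₛ : Within n (suc k) Gₛ
    withinₛ x = by-cases (Ω x ℕ.≟ k) (within x)
      where
      by-cases : Dec (Ω x ≡ k) → Absorbing G x ⊎ (k ≤ Ω x × Ω x < k + suc n) →
                 Absorbing Gₛ x ⊎ (suc k ≤ Ωₛ x × Ωₛ x < suc k + n)
      by-cases (yes eq) _          = inj₁ (nextₛ-stop eq)
      by-cases (no ≢k) (inj₁ abs) = inj₁ λ c b → trans (nextₛ-go ≢k c b) (abs c b)
      by-cases (no ≢k) (inj₂ (k≤ , <k)) =
        inj₂ (subst (suc k ≤_) (sym (Ωₛ-go ≢k)) (≤∧≢⇒< k≤ (≢k ∘ sym)) ,
              subst₂ _<_ (sym (Ωₛ-go ≢k)) (+-suc k n) <k)

    safe-if-winsₛ : ∀ s {x} → Ω x ≡ k → Wins Gₛ s x → Safe x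
    safe-if-winsₛ s {x} eq w = dne λ unsafe →
      parity-exclusive (w (λ _ → x) refl λ _ → b₀ , sym (nextₛ-stop eq (s x) b₀))
                       (parity-const λ _ → Ωₛ-unsafe eq unsafe)

    unsafe-if-losesₛ : ∀ s {x} → Ω x ≡ k → Wins (dual Gₛ) s x → ¬ Safe x
    unsafe-if-losesₛ s {x} eq w safe =
      parity-exclusive (w (λ _ → x) refl λ _ → c₀ , sym (nextₛ-stop eq c₀ _))
                       (parity-const λ _ → cong suc (Ωₛ-safe eq safe))

    module Opponent (τₛ : X → C → B) where
      σ : X → C → B
      σ x with em {W x}
      ... | yes _ = τ x
      ... | no  _ with em {∀ c → ∃[ b ] W (next x c b)}
      ...   | yes f = proj₁ ∘ f
      ...   | no  _ = τₛ x

      σ-W : ∀ {x} → W x → σ x ≡ τ x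
      σ-W {x} w with em {W x}
      ... | yes _ = refl
      ... | no ¬w = ⊥-elim (¬w w)

      σ-force : ∀ {x} → (∀ c → ∃[ b ] W (next x c b)) → ∀ c → W (next x c (σ x c))
      σ-force {x} f c with em {W x}
      ... | yes w = W-closed x w c
      ... | no  _ with em {∀ c → ∃[ b ] W (next x c b)}
      ...   | yes f′ = proj₂ (f′ c)
      ...   | no ¬f  = ⊥-elim (¬f f)

      σ-go : ∀ {x} → ¬ W x → ¬ (∀ c → ∃[ b ] W (next x c b)) → σ x ≡ τₛ x
      σ-go {x} ¬w ¬f with em {W x}
      ... | yes w = ⊥-elim (¬w w)
      ... | no  _ with em {∀ c → ∃[ b ] W (next x c b)}
      ...   | yes f = ⊥-elim (¬f f)
      ...   | no  _ = refl

      -- A play that enters `W` follows `τ` from then on. One that never does cannot meet priority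
      -- `k`: a position of priority `k` lost in `Gₛ` is not safe, so `W` could be forced at once.
      -- It is then a play of `Gₛ` according to `τₛ`.
      σ-wins : ∀ {x} → Wins (dual Gₛ) τₛ x → Wins (dual G) σ x
      σ-wins {x} w π refl play with em {∃[ m ] W (π m)}
      ... | yes (m , wm) = wins-tail (dual G) τ π m follow (τ-wins _ wm)
        where
        inW : ∀ n → W (π (m + n))
        follow : ∀ n → ∃[ c ] π (suc (m + n)) ≡ next (π (m + n)) c (τ (π (m + n)) c)
        follow n = let c , eq = play (m + n) in
          c , trans eq (cong (λ f → next (π (m + n)) c (f c)) (σ-W (inW n)))
        inW zero    = subst (W ∘ π) (sym (+-identityʳ m)) wm
        inW (suc n) = let c , eq = follow n in
          subst W (sym (trans (cong π (+-suc m n)) eq)) (W-closed _ (inW n) c)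
      ... | no never = parity-cong (λ n → cong suc (Ωₛ-go (≢k n))) (w π refl playₛ)
        where
        winsₛ : ∀ n → Wins (dual Gₛ) τₛ (π n)
        ¬force : ∀ n → ¬ (∀ c → ∃[ b ] W (next (π n) c b))
        ¬force n f = let c , eq = play n in never (suc n , subst W (sym eq) (σ-force f c))
        ≢k : ∀ n → Ω (π n) ≢ k
        ≢k n eq = ¬force n λ c → dne λ ¬b →
          unsafe-if-losesₛ τₛ eq (winsₛ n) (c , λ b wb → ¬b (b , wb))
        playₛ : Play (dual Gₛ) τₛ π
        playₛ n = let c , eq = play n in
          c , trans eq (trans (cong (λ f → next (π n) c (f c)) (σ-go (λ w → never (n , w)) (¬force n)))
                              (sym (nextₛ-go (≢k n) c _)))
        winsₛ zero    = w
        winsₛ (suc n) = let c , eq = playₛ n in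
          subst (Wins (dual Gₛ) τₛ) (sym eq) (wins-step (dual Gₛ) τₛ (winsₛ n) c)

    ¬W⇒winₛ : ∀ x → ¬ W x → Win Gₛ x
    ¬W⇒winₛ x ¬w with determined Gₛ withinₛ x
    ... | inj₁ win       = win
    ... | inj₂ (τₛ , w) = ⊥-elim (¬w (Opponent.σ τₛ , Opponent.σ-wins τₛ w))

    sₛ : X → C
    sₛ = merge Gₛ (¬_ ∘ W) ¬W⇒winₛ .proj₁

    sₛ-wins : ∀ x → ¬ W x → Wins Gₛ sₛ x
    sₛ-wins = merge Gₛ (¬_ ∘ W) ¬W⇒winₛ .proj₂

    s : X → C
    s x with Ω x ℕ.≟ k | em {Safe x}
    ... | yes _ | yes (c , _) = c
    ... | _     | _           = sₛ x

    s-safe : ∀ {x} → Ω x ≡ k → Safe x → ∀ b → ¬ W (next x (s x) b)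
    s-safe {x} eq safe with Ω x ℕ.≟ k | em {Safe x}
    ... | yes _ | yes (_ , ok) = ok
    ... | yes _ | no unsafe    = ⊥-elim (unsafe safe)
    ... | no ≢k | _            = ⊥-elim (≢k eq)

    s-go : ∀ {x} → Ω x ≢ k → s x ≡ sₛ x
    s-go {x} ≢k with Ω x ℕ.≟ k | em {Safe x}
    ... | yes eq | _     = ⊥-elim (≢k eq)
    ... | no _   | yes _ = refl
    ... | no _   | no _  = refl

    -- Every position of the play is winning for `sₛ`, since a safe choice at priority `k` lands
    -- outside `W`, where `sₛ` wins afresh. Either `k` recurs, being even and minimal, or the play
    -- is eventually one of `Gₛ`.
    s-wins : ∀ x → ¬ W x → Wins G s x
    s-wins x ¬w π refl play = conclude
      where
      step-go : ∀ n → Ω (π n) ≢ k → ∃[ b ] π (suc n) ≡ nextₛ (π n) (sₛ (π n)) b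
      step-go n ≢k = let b , eq = play n in
        b , trans eq (trans (cong (λ c → next (π n) c b) (s-go ≢k)) (sym (nextₛ-go ≢k _ b)))
      winsₛ : ∀ n → Wins Gₛ sₛ (π n)
      winsₛ zero = sₛ-wins _ ¬w
      winsₛ (suc n) with Ω (π n) ℕ.≟ k
      ... | yes eq = let b , e = play n in
        sₛ-wins _ (subst (¬_ ∘ W) (sym e) (s-safe eq (safe-if-winsₛ sₛ eq (winsₛ n)) b))
      ... | no ≢k  = let b , e = step-go n ≢k in
        subst (Wins Gₛ sₛ) (sym e) (wins-step Gₛ sₛ (winsₛ n) b)
      constant : ∀ n → Absorbing G (π n) → ∀ m → π (m + n) ≡ π n
      constant n abs zero    = refl
      constant n abs (suc m) = let b , e = play (m + n) in
        trans e (trans (cong (λ y → next y (s y) b) (constant n abs m)) (abs _ b))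
      conclude : Parity true (Ω ∘ π)
      conclude with em {Infinitely (λ n → Ω (π n) ≡ k)}
      ... | yes inf = k , k-even , (0 , λ n _ → k≤ n) , inf
        where
        k≤ : ∀ n → k ≤ Ω (π n)
        k≤ n with within (π n)
        ... | inj₂ (le , _) = le
        -- An absorbing position may have any priority, but the play is stuck there, so its priority
        -- is the recurring `k`.
        ... | inj₁ abs with inf n
        ...   | m , n≤m , eq =
          ≤-reflexive (trans (sym eq) (cong Ω (trans (cong π (sym (m∸n+n≡m n≤m))) (constant n abs (m ∸ n)))))
      ... | no ¬inf with ¬infinitely ¬inf
      ...   | N , ≢k =
        parity-undrop N (parity-cong (λ n → Ωₛ-go (≢k (N + n) (m≤m+n N n)))
          (parity-drop N (wins-tail Gₛ sₛ π N (λ n → step-go (N + n) (≢k (N + n) (m≤m+n N n))) (winsₛ N))))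

    result : Determined G
    result x with em {W x}
    ... | yes w = inj₂ w
    ... | no ¬w = inj₁ (s , s-wins x ¬w)

  determined-within : ∀ n k G → Within n k G → Determined G
  determined-within zero k G within x with within x
  ... | inj₂ (k≤ , <k) = ⊥-elim (<-irrefl refl (≤-<-trans k≤ (subst (Game.Ω G x <_) (+-identityʳ k) <k)))
  ... | inj₁ abs = by-parity (even (Ω x)) refl
    where
    open Game G
    constant : ∀ s {π} → π 0 ≡ x → Play G s π → ∀ n → π n ≡ x
    constant s eq play zero    = eq
    constant s eq play (suc n) = let b , e = play n in
      trans e (trans (cong (λ y → next y (s y) b) (constant s eq play n)) (abs _ b))
    constant′ : ∀ {s π} → π 0 ≡ x → Play (dual G) s π → ∀ n → π n ≡ x
    constant′ eq play zero    = eq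
    constant′ {s} eq play (suc n) = let c , e = play n in
      trans e (trans (cong (λ y → next y c (s y c)) (constant′ {s} eq play n)) (abs c _))
    by-parity : ∀ b → even (Ω x) ≡ b → Win G x ⊎ Win (dual G) x
    by-parity true  e = inj₁ ((λ _ → c₀) , λ π eq play →
      subst (λ b → Parity b (Ω ∘ π)) e (parity-const (λ n → cong Ω (constant (λ _ → c₀) eq play n))))
    by-parity false e = inj₂ ((λ _ _ → b₀) , λ π eq play →
      subst (λ b → Parity (not b) (suc ∘ Ω ∘ π)) e
        (parity-const (λ n → cong (suc ∘ Ω) (constant′ {λ _ _ → b₀} eq play n))))
  determined-within (suc n) k G within with even k in eq
  ... | true  = Step.result n k (determined-within n (suc k)) eq G within
  -- An odd least priority becomes even in the dual game, whose priorities are shifted by one.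
  ... | false = λ x → swap (Step.result n (suc k) (determined-within n (suc (suc k)))
                             (cong not eq) (dual G) within′ x)
    where
    swap : ∀ {x} → Win (dual G) x ⊎ Win (dual (dual G)) x → Win G x ⊎ Win (dual G) x
    swap (inj₁ l) = inj₂ l
    swap (inj₂ w) = inj₁ (win-undual² G w)
    within′ : Within (suc n) (suc k) (dual G)
    within′ x with within x
    ... | inj₁ abs       = inj₁ λ f c → abs c (f c)
    ... | inj₂ (k≤ , <k) = inj₂ (s≤s k≤ , s≤s <k)

  determined : ∀ {K} (G : Game X) → (∀ x → Game.Ω G x < K) → Determined G
  determined {K} G bound = determined-within K 0 G λ x → inj₂ (z≤n , bound x)

-- If H is determined then a positional opponent strategy in H can be played
-- against a positional strategy in G, which keeps the simulation functional.
win-simulation :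
  ∀ {X Y} (G : Game X) (H : Game Y) (R : X → Y → Set) →
  (∀ {x y} → R x y → Game.Ω G x ≡ Game.Ω H y) →
  (∀ {x y} → R x y → ∀ c → ∃[ c′ ] ∀ b′ → ∃[ b ] R (Game.next G x c b) (Game.next H y c′ b′)) →
  ∀ {x y} → R x y → Win H y ⊎ Win (dual H) y → Win G x → Win H y
win-simulation G H R R⇒Ω step r (inj₁ win) _ = win
win-simulation {X} {Y} G H R R⇒Ω step {x} {y} r (inj₂ (τ , lose)) (s , win) =
  ⊥-elim (parity-exclusive
    (parity-cong (λ n → R⇒Ω (proj₂ (pairs n))) (win (x′ ∘ pairs) refl λ n → _ , refl))
    (parity-pred (lose (y′ ∘ pairs) refl λ n → _ , refl)))
  where
  Pair = Σ[ (x , y) ∈ X × Y ] R x y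
  x′ : Pair → X
  x′ ((x , _) , _) = x
  y′ : Pair → Y
  y′ ((_ , y) , _) = y
  advance : Pair → Pair
  advance ((x , y) , r) =
    let c′ , reply = step r (s x) ; b , r′ = reply (τ y c′) in (_ , _) , r′
  pairs : ℕ → Pair
  pairs zero    = (x , y) , r
  pairs (suc n) = advance (pairs n)

-- Finite types

record Finite (A : Set) : Set where
  field
    size    : ℕ
    enc     : A → Fin size
    dec     : Fin size → A
    dec-enc : ∀ a → dec (enc a) ≡ a

  enc-injective : ∀ {a b} → enc a ≡ enc b → a ≡ b
  enc-injective {a} {b} eq = trans (sym (dec-enc a)) (trans (cong dec eq) (dec-enc b))

  _≟_ : (a b : A) → Dec (a ≡ b)
  a ≟ b = map′ enc-injective (cong enc) (enc a Fin.≟ enc b)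

  exists? : {P : A → Set} → (∀ a → Dec (P a)) → Dec (∃[ a ] P a)
  exists? {P} P? = map′ (λ (i , p) → dec i , p) (λ (a , p) → enc a , subst P (sym (dec-enc a)) p)
                        (Fin.any? (P? ∘ dec))

  -- Boolean vectors rather than predicates, because sets of states and sets of arrows must
  -- themselves form finite types with decidable equality.
  Sub : Set
  Sub = Vec Bool size

  infix 4 _∈_ _∈?_

  _∈_ : A → Sub → Set
  a ∈ s = T (lookup s (enc a))

  _∈?_ : ∀ a s → Dec (a ∈ s)
  a ∈? s = T? (lookup s (enc a))

  ⟪_⟫ : {P : A → Set} → (∀ a → Dec (P a)) → Sub
  ⟪ P? ⟫ = tabulate (λ i → ⌊ P? (dec i) ⌋)

  ∈⟪⟫⁻ : ∀ {P : A → Set} (P? : ∀ a → Dec (P a)) {a} → a ∈ ⟪ P? ⟫ → P a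
  ∈⟪⟫⁻ {P} P? {a} t =
    subst P (dec-enc a) (toWitness (subst T (lookup∘tabulate _ (enc a)) t))

  ∈⟪⟫⁺ : ∀ {P : A → Set} (P? : ∀ a → Dec (P a)) {a} → P a → a ∈ ⟪ P? ⟫
  ∈⟪⟫⁺ {P} P? {a} p =
    subst T (sym (lookup∘tabulate _ (enc a))) (fromWitness (subst P (sym (dec-enc a)) p))

open Finite

finite-⊤ : Finite ⊤
finite-⊤ = record { size = 1 ; enc = λ _ → zero ; dec = λ _ → tt ; dec-enc = λ _ → refl }

finite-Bool : Finite Bool
finite-Bool = record
  { size = 2
  ; enc = λ { true → zero ; false → suc zero }
  ; dec = λ { zero → true ; (suc zero) → false }
  ; dec-enc = λ { true → refl ; false → refl } }

finite-Fin : ∀ n → Finite (Fin n)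
finite-Fin n = record { size = n ; enc = id ; dec = id ; dec-enc = λ _ → refl }

infixr 4 _×-finite_
infixr 3 _⊎-finite_

_×-finite_ : ∀ {A B : Set} → Finite A → Finite B → Finite (A × B)
F ×-finite G = record
  { size = size F * size G
  ; enc = λ (a , b) → combine (enc F a) (enc G b)
  ; dec = λ i → let (j , k) = remQuot (size G) i in dec F j , dec G k
  ; dec-enc = λ (a , b) →
      trans (cong (λ (j , k) → dec F j , dec G k) (Fin.remQuot-combine (enc F a) (enc G b)))
            (cong₂ _,_ (dec-enc F a) (dec-enc G b)) }

_⊎-finite_ : ∀ {A B : Set} → Finite A → Finite B → Finite (A ⊎ B)
_⊎-finite_ {A} {B} F G = record
  { size = size F + size G
  ; enc = λ x → join (size F) (size G) (encode x)
  ; dec = λ i → decode (splitAt (size F) i)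
  ; dec-enc = λ x → trans (cong decode (Fin.splitAt-join (size F) (size G) (encode x))) (decode-encode x) }
  where
  encode : A ⊎ B → Fin (size F) ⊎ Fin (size G)
  encode (inj₁ a) = inj₁ (enc F a)
  encode (inj₂ b) = inj₂ (enc G b)
  decode : Fin (size F) ⊎ Fin (size G) → A ⊎ B
  decode (inj₁ i) = inj₁ (dec F i)
  decode (inj₂ j) = inj₂ (dec G j)
  decode-encode : ∀ x → decode (encode x) ≡ x
  decode-encode (inj₁ a) = cong inj₁ (dec-enc F a)
  decode-encode (inj₂ b) = cong inj₂ (dec-enc G b)

finite-retract : ∀ {A B : Set} (f : A → B) (g : B → A) → (∀ a → g (f a) ≡ a) → Finite B → Finite A
finite-retract f g gf F = record
  { size = size F ; enc = enc F ∘ f ; dec = g ∘ dec F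
  ; dec-enc = λ a → trans (cong g (dec-enc F (f a))) (gf a) }

finite-Maybe : ∀ {A : Set} → Finite A → Finite (Maybe A)
finite-Maybe F = finite-retract
  (λ { nothing → inj₁ tt ; (just a) → inj₂ a }) (λ { (inj₁ _) → nothing ; (inj₂ a) → just a })
  (λ { nothing → refl ; (just _) → refl }) (finite-⊤ ⊎-finite F)

finite-Vec : ∀ {A : Set} → Finite A → ∀ n → Finite (Vec A n)
finite-Vec F zero = finite-retract (λ _ → tt) (λ _ → []) (λ { [] → refl }) finite-⊤
finite-Vec F (suc n) = finite-retract
  (λ { (x ∷ xs) → x , xs }) (λ (x , xs) → x ∷ xs) (λ { (_ ∷ _) → refl })
  (F ×-finite finite-Vec F n)

-- Determinisation of parity automata on words

infixl 7 _⊓ᶠ_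

_⊓ᶠ_ : ∀ {n} → Fin n → Fin n → Fin n
i ⊓ᶠ j with ≤-total (toℕ i) (toℕ j)
... | inj₁ _ = i
... | inj₂ _ = j

toℕ-⊓ᶠ : ∀ {n} (i j : Fin n) → toℕ (i ⊓ᶠ j) ≡ toℕ i ⊓ toℕ j
toℕ-⊓ᶠ i j with ≤-total (toℕ i) (toℕ j)
... | inj₁ i≤j = sym (m≤n⇒m⊓n≡m i≤j)
... | inj₂ j≤i = sym (m≥n⇒m⊓n≡n j≤i)

⊓ᶠ-assoc : ∀ {n} (i j k : Fin n) → i ⊓ᶠ j ⊓ᶠ k ≡ i ⊓ᶠ (j ⊓ᶠ k)
⊓ᶠ-assoc i j k = Fin.toℕ-injective (begin
  toℕ (i ⊓ᶠ j ⊓ᶠ k)         ≡⟨ toℕ-⊓ᶠ (i ⊓ᶠ j) k ⟩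
  toℕ (i ⊓ᶠ j) ⊓ toℕ k      ≡⟨ cong (_⊓ toℕ k) (toℕ-⊓ᶠ i j) ⟩
  toℕ i ⊓ toℕ j ⊓ toℕ k     ≡⟨ ⊓-assoc (toℕ i) (toℕ j) (toℕ k) ⟩
  toℕ i ⊓ (toℕ j ⊓ toℕ k)   ≡⟨ cong (toℕ i ⊓_) (toℕ-⊓ᶠ j k) ⟨
  toℕ i ⊓ toℕ (j ⊓ᶠ k)      ≡⟨ toℕ-⊓ᶠ i (j ⊓ᶠ k) ⟨
  toℕ (i ⊓ᶠ (j ⊓ᶠ k))       ∎)
  where open ≡-Reasoning

module Determinisation {Q : Set} (finite-Q : Finite Q) (K : ℕ) where

  finite-Arrow : Finite (Q × Fin K × Q)
  finite-Arrow = finite-Q ×-finite finite-Fin K ×-finite finite-Q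

  -- The type of a word segment: the pairs of states joined by a trace through it, each with the
  -- least priority met on the way. Segments are concatenated by `⊙`.
  Table : Set
  Table = Sub finite-Arrow

  finite-Table : Finite Table
  finite-Table = finite-Vec finite-Bool (size finite-Arrow)

  infix 4 _-[_,_]→_

  _-[_,_]→_ : Q → Table → Fin K → Q → Set
  q -[ s , k ]→ q′ = _∈_ finite-Arrow (q , k , q′) s

  Composite : Table → Table → Q × Fin K × Q → Set
  Composite s s′ (q , k , q″) =
    Σ[ (q′ , k₁ , k₂) ∈ Q × Fin K × Fin K ] (q -[ s , k₁ ]→ q′) × (q′ -[ s′ , k₂ ]→ q″) × k ≡ k₁ ⊓ᶠ k₂

  composite? : ∀ s s′ x → Dec (Composite s s′ x)
  composite? s s′ (q , k , q″) =
    exists? (finite-Q ×-finite finite-Fin K ×-finite finite-Fin K) λ (q′ , k₁ , k₂) →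
      _∈?_ finite-Arrow (q , k₁ , q′) s ×-dec _∈?_ finite-Arrow (q′ , k₂ , q″) s′
        ×-dec k Fin.≟ k₁ ⊓ᶠ k₂

  infixl 7 _⊙_

  _⊙_ : Table → Table → Table
  s ⊙ s′ = ⟪_⟫ finite-Arrow (composite? s s′)

  States : Set
  States = Sub finite-Q

  singleton : Q → States
  singleton q₀ = ⟪_⟫ finite-Q (λ q → _≟_ finite-Q q q₀)

  Image : States → Table → Q → Set
  Image R s q′ = Σ[ (q , k) ∈ Q × Fin K ] _∈_ finite-Q q R × (q -[ s , k ]→ q′)

  image? : ∀ R s q′ → Dec (Image R s q′)
  image? R s q′ = exists? (finite-Q ×-finite finite-Fin K) λ (q , k) →
    _∈?_ finite-Q q R ×-dec _∈?_ finite-Arrow (q , k , q′) s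

  image : States → Table → States
  image R s = ⟪_⟫ finite-Q (image? R s)

  -- If the word is typed R·e·e·e…, then some trace through it violates the
  -- parity condition iff R and e contain the following lasso.
  OddLasso : States → Table → Set
  OddLasso R e = Σ[ (q₁ , k₁ , q , k) ∈ Q × Fin K × Q × Fin K ] _∈_ finite-Q q₁ R × (q₁ -[ e , k₁ ]→ q) ×
                   (q -[ e , k ]→ q) × T (not (even (toℕ k)))

  oddLasso? : ∀ R e → Dec (OddLasso R e)
  oddLasso? R e =
    exists? (finite-Q ×-finite finite-Fin K ×-finite finite-Q ×-finite finite-Fin K)
      λ (q₁ , k₁ , q , k) →
        _∈?_ finite-Q q₁ R ×-dec _∈?_ finite-Arrow (q₁ , k₁ , q) e
          ×-dec _∈?_ finite-Arrow (q , k , q) e ×-dec T? (not (even (toℕ k)))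

  accepts : States → Table → Bool
  accepts R e = not ⌊ oddLasso? R e ⌋

  -- A state u₁ … u_r lists the types of consecutive segments of the word read
  -- so far; slot j is the position where the segment of u_j starts.
  Slots : ℕ → Set
  Slots zero    = ⊤
  Slots (suc n) = Maybe (Table × Slots n)

  empty : ∀ n → Slots n
  empty zero    = tt
  empty (suc n) = nothing

  finite-Slots : ∀ n → Finite (Slots n)
  finite-Slots zero    = finite-⊤
  finite-Slots (suc n) = finite-Maybe (finite-Table ×-finite finite-Slots n)

  product : ∀ n → Slots n → Table → Table
  product zero    _               a = a
  product (suc n) nothing         a = a
  product (suc n) (just (u , us)) a = u ⊙ product n us a

  if-equal : Table → Table → Table → Maybe Table → Maybe Table
  if-equal s t e m = if ⌊ _≟_ finite-Table s t ⌋ then just e else m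

  -- Looks for a slot whose suffix product is t; returns the type e of the
  -- segment leading there.
  detect : ∀ n → Table → Table → Slots n → Table → Maybe Table
  detect zero    e t _               a = if-equal a t e nothing
  detect (suc n) e t nothing         a = if-equal a t e nothing
  detect (suc n) e t (just (u , us)) a =
    if-equal (u ⊙ product n us a) t e (detect n (e ⊙ u) t us a)

  priorities : ℕ → ℕ
  priorities zero    = 3
  priorities (suc n) = suc (suc (priorities n))

  -- Priorities 2j and 2j + 1 report a repetition found at slot j.  In the limit
  -- the least slot with infinitely many reports is never dropped, and its reports
  -- factorise the word into segments of a fixed type e.
  verdict : ∀ {n} → Bool → Fin (suc (suc n))
  verdict true  = zero
  verdict false = suc zero

  -- The priority for opening a slot. This recurs only if an earlier slot keeps dropping the opened
  -- one, and then that earlier slot reports a smaller priority infinitely often.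
  two : ∀ n → Fin (priorities (suc n))
  two zero    = suc (suc zero)
  two (suc n) = suc (suc zero)

  step    : ∀ n → States → Slots n → Table → Slots n × Fin (priorities n)
  resolve : ∀ n → States → Table → Slots n → Table → Maybe Table →
            Slots (suc n) × Fin (priorities (suc n))

  -- Unreachable when starting from `capacity` slots, by `event`; the priority is arbitrary.
  step zero    R _               a = tt , zero
  step (suc n) R nothing         a = just (a , empty n) , two n
  step (suc n) R (just (u , us)) a = resolve n R u us a (detect n u (u ⊙ product n us a) us a)

  -- When the first slot and a later one have the same suffix product, the word
  -- read from now on cannot tell them apart, and the later slots are dropped.
  resolve n R u us a (just e) = just (u ⊙ product n us a , empty n) , verdict (accepts R e)
  resolve n R u us a nothing  =
    let us′ , k = step n (image R u) us a in just (u , us′) , suc (suc k)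

  -- The situation in which `step` would run out of slots: all are in use and no suffix product
  -- repeats.
  NoEvent : ∀ n → Slots n → Table → Set
  NoEvent zero    _               a = ⊤
  NoEvent (suc n) nothing         a = ⊥
  NoEvent (suc n) (just (u , us)) a =
    detect n u (u ⊙ product n us a) us a ≡ nothing × NoEvent n us a

  if-equal-just : ∀ s t e m {e′} → if-equal s t e m ≡ just e′ →
                  (s ≡ t × e ≡ e′) ⊎ (s ≢ t × m ≡ just e′)
  if-equal-just s t e m eq with _≟_ finite-Table s t
  if-equal-just s t e m refl | yes s≡t = inj₁ (s≡t , refl)
  ... | no s≢t = inj₂ (s≢t , eq)

  if-equal-nothing : ∀ s t e m → if-equal s t e m ≡ nothing → s ≢ t × m ≡ nothing
  if-equal-nothing s t e m eq with _≟_ finite-Table s t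
  if-equal-nothing s t e m () | yes _
  ... | no s≢t = s≢t , eq

  suffix : ∀ n (us : Slots n) a → NoEvent n us a → Fin n → Table
  suffix (suc n) (just (u , us)) a (_ , ne) zero    = u ⊙ product n us a
  suffix (suc n) (just (u , us)) a (_ , ne) (suc i) = suffix n us a ne i

  suffix-≢ : ∀ n (us : Slots n) a ne e t → detect n e t us a ≡ nothing → ∀ i → suffix n us a ne i ≢ t
  suffix-≢ (suc n) (just (u , us)) a (_ , ne) e t eq zero =
    proj₁ (if-equal-nothing _ t e _ eq)
  suffix-≢ (suc n) (just (u , us)) a (_ , ne) e t eq (suc i) =
    suffix-≢ n us a ne (e ⊙ u) t (proj₂ (if-equal-nothing _ t e _ eq)) i

  suffix-distinct : ∀ n (us : Slots n) a ne {i j} → i Fin.< j → suffix n us a ne i ≢ suffix n us a ne j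
  suffix-distinct (suc n) (just (u , us)) a (d , ne) {zero} {suc j} _ eq = suffix-≢ n us a ne u _ d j (sym eq)
  suffix-distinct (suc n) (just (u , us)) a (d , ne) {suc i} {suc j} (s≤s i<j) eq =
    suffix-distinct n us a ne i<j eq

  -- One slot more than there are tables, so that the suffix products of full slots collide by the
  -- pigeonhole principle.
  capacity : ℕ
  capacity = suc (size finite-Table)

  event : ∀ us a → ¬ NoEvent capacity us a
  event us a ne =
    let i , j , i<j , eq = Fin.pigeonhole ≤-refl (enc finite-Table ∘ suffix capacity us a ne) in
    suffix-distinct capacity us a ne i<j (enc-injective finite-Table eq)

-- Traces through a word and the types of its segments

module Word {Q : Set} (finite-Q : Finite Q) (K : ℕ)
            (a : ℕ → Determinisation.Table finite-Q K) where
  open Determinisation finite-Q K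

  data Trace : ℕ → ℕ → Q → Fin K → Q → Set where
    one  : ∀ {i q k q′} → q -[ a i , k ]→ q′ → Trace i (suc i) q k q′
    cons : ∀ {i j q k k′ k″ q′ q″} → q -[ a i , k ]→ q′ → Trace (suc i) j q′ k′ q″ →
           k″ ≡ k ⊓ᶠ k′ → Trace i j q k″ q″

  trace-< : ∀ {i j q k q′} → Trace i j q k q′ → i < j
  trace-< (one _)       = ≤-refl
  trace-< (cons _ tr _) = <-trans (n<1+n _) (trace-< tr)

  append : ∀ {i j l q k₁ q′ k₂ q″} → Trace i j q k₁ q′ → Trace j l q′ k₂ q″ →
           Trace i l q (k₁ ⊓ᶠ k₂) q″
  append (one x)          tr′ = cons x tr′ refl
  append {k₂ = k₂} (cons {k = k} {k′} x tr refl) tr′ = cons x (append tr tr′) (⊓ᶠ-assoc k k′ k₂)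

  split : ∀ {i j l q k q″} → Trace i l q k q″ → i < j → j < l →
          ∃[ q′ ] ∃[ k₁ ] ∃[ k₂ ] Trace i j q k₁ q′ × Trace j l q′ k₂ q″ × k ≡ k₁ ⊓ᶠ k₂
  split (one _) i<j j<1+i = ⊥-elim (<-irrefl refl (<-≤-trans i<j (s≤s⁻¹ j<1+i)))
  split {i} {j} (cons {k = k} x tr eq) i<j j<l with m≤n⇒m<n∨m≡n i<j
  ... | inj₂ refl = _ , _ , _ , one x , tr , eq
  ... | inj₁ 1+i<j with split tr 1+i<j j<l
  ...   | q′ , k₁ , k₂ , tr₁ , tr₂ , refl =
    q′ , _ , k₂ , cons x tr₁ refl , tr₂ , trans eq (sym (⊓ᶠ-assoc k k₁ k₂))

  record Typed (i j : ℕ) (s : Table) : Set where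
    field
      ∈⇒trace : ∀ {q k q′} → q -[ s , k ]→ q′ → Trace i j q k q′
      trace⇒∈ : ∀ {q k q′} → Trace i j q k q′ → q -[ s , k ]→ q′
  open Typed

  typed-letter : ∀ i → Typed i (suc i) (a i)
  typed-letter i .∈⇒trace x               = one x
  typed-letter i .trace⇒∈ (one x)         = x
  typed-letter i .trace⇒∈ (cons _ tr _) = ⊥-elim (<-irrefl refl (trace-< tr))

  typed-⊙ : ∀ {i j l s s′} → i < j → j < l → Typed i j s → Typed j l s′ → Typed i l (s ⊙ s′)
  typed-⊙ {s = s} {s′} i<j j<l t t′ .∈⇒trace x =
    let _ , x₁ , x₂ , eq = ∈⟪⟫⁻ finite-Arrow (composite? s s′) x in
    subst (λ k → Trace _ _ _ k _) (sym eq) (append (t .∈⇒trace x₁) (t′ .∈⇒trace x₂))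
  typed-⊙ {s = s} {s′} i<j j<l t t′ .trace⇒∈ tr =
    let _ , _ , _ , tr₁ , tr₂ , eq = split tr i<j j<l in
    ∈⟪⟫⁺ finite-Arrow (composite? s s′) (_ , t .trace⇒∈ tr₁ , t′ .trace⇒∈ tr₂ , eq)

  -- The segments from i and from j look alike at l, hence at any later time.
  typed-transfer : ∀ {i j l m v e} → i < l → j < l → l ≤ m →
                   Typed i l v → Typed j l v → Typed i m e → Typed j m e
  typed-transfer {l = l} {m} {v} i<l j<l l≤m tᵢ tⱼ t = record
    { ∈⇒trace = λ x → exchange i<l tᵢ tⱼ (t .∈⇒trace x)
    ; trace⇒∈ = λ tr → t .trace⇒∈ (exchange j<l tⱼ tᵢ tr) }
    where
    exchange : ∀ {i j q k q″} → i < l → Typed i l v → Typed j l v → Trace i m q k q″ → Trace j m q k q″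
    exchange i<l t t′ tr with m≤n⇒m<n∨m≡n l≤m
    ... | inj₂ refl = t′ .∈⇒trace (t .trace⇒∈ tr)
    ... | inj₁ l<m  = let _ , _ , _ , tr₁ , tr₂ , eq = split tr i<l l<m in
      subst (λ k → Trace _ m _ k _) (sym eq) (append (t′ .∈⇒trace (t .trace⇒∈ tr₁)) tr₂)

  module From (q₀ : Q) where

    data Reach : ℕ → Q → Set where
      start : Reach 0 q₀
      move  : ∀ {i q k q′} → Reach i q → q -[ a i , k ]→ q′ → Reach (suc i) q′

    reach-trace : ∀ {i j q k q′} → Reach i q → Trace i j q k q′ → ∃[ k′ ] Trace 0 j q₀ k′ q′
    reach-trace start      tr = _ , tr
    reach-trace (move r x) tr = reach-trace r (cons x tr refl)

    reach-append : ∀ {i j q k q′} → Reach i q → Trace i j q k q′ → Reach j q′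
    reach-append r (one x)       = move r x
    reach-append r (cons x tr _) = reach-append (move r x) tr

    reach-split : ∀ {i j q′} → i < j → Reach j q′ → ∃[ q ] ∃[ k ] Reach i q × Trace i j q k q′
    reach-split {i} {suc j} i<1+j (move r x) with m≤n⇒m<n∨m≡n (s≤s⁻¹ i<1+j)
    ... | inj₂ refl = _ , _ , r , one x
    ... | inj₁ i<j  = let q , k , r′ , tr = reach-split i<j r in q , _ , r′ , append tr (one x)

    record Prefix (i : ℕ) (R : States) : Set where
      field
        ∈⇒reach : ∀ {q} → _∈_ finite-Q q R → Reach i q
        reach⇒∈ : ∀ {q} → Reach i q → _∈_ finite-Q q R
    open Prefix

    prefix-image : ∀ {i j R u} → i < j → Prefix i R → Typed i j u → Prefix j (image R u)
    prefix-image {R = R} {u} i<j p t .∈⇒reach x =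
      let _ , r , y = ∈⟪⟫⁻ finite-Q (image? R u) x in
      reach-append (p .∈⇒reach r) (t .∈⇒trace y)
    prefix-image {R = R} {u} i<j p t .reach⇒∈ r =
      let _ , _ , r′ , tr = reach-split i<j r in
      ∈⟪⟫⁺ finite-Q (image? R u) (_ , p .reach⇒∈ r′ , t .trace⇒∈ tr)

    -- The kind of factorisation that Ramsey's theorem provides. Here it is read off the reports of
    -- a slot, so that the verdict of the automaton concerns the same `R` and `e`.
    Factorisation : States → Table → Set
    Factorisation R e = ∃[ i ] Prefix i R × Σ[ g ∈ (ℕ → ℕ) ]
      (∀ n → i < g n × Typed i (g n) e) × (∀ {n n′} → n < n′ → g n < g n′ × Typed (g n) (g n′) e)

    -- `b` bounds the end of the first segment from below. A report of the first slot at time `m`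
    -- moves that end to `m + 1`, so that later reports find their slots arbitrarily late.
    Segmented : ∀ n → ℕ → ℕ → ℕ → Slots n → Set
    Segmented zero    b i m _               = i ≡ m
    Segmented (suc n) b i m nothing         = i ≡ m
    Segmented (suc n) b i m (just (u , us)) =
      ∃[ j ] b ≤ j × i < j × Typed i j u × Segmented n 0 j m us

    segmented-≤ : ∀ n {b i m} us → Segmented n b i m us → i ≤ m
    segmented-≤ zero    us              eq = ≤-reflexive eq
    segmented-≤ (suc n) nothing         eq = ≤-reflexive eq
    segmented-≤ (suc n) (just (u , us)) (j , _ , i<j , _ , sg) = ≤-trans (<⇒≤ i<j) (segmented-≤ n us sg)

    segmented-empty : ∀ n {b i} → Segmented n b i i (empty n)
    segmented-empty zero    = refl
    segmented-empty (suc n) = refl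

    product-typed : ∀ n {b i m} us → Segmented n b i m us → Typed i (suc m) (product n us (a m))
    product-typed zero    us              refl = typed-letter _
    product-typed (suc n) nothing         refl = typed-letter _
    product-typed (suc n) (just (u , us)) (j , _ , i<j , t , sg) =
      typed-⊙ i<j (s≤s (segmented-≤ n us sg)) t (product-typed n us sg)

    detect-sound : ∀ n {b i j m e t e′} us → i < j → Typed i j e → Segmented n b j m us →
                   detect n e t us (a m) ≡ just e′ →
                   ∃[ l ] j ≤ l × l ≤ m × Typed i l e′ × Typed l (suc m) t
    detect-sound zero {e = e} {t} us i<j te refl eq with if-equal-just _ t e _ eq
    ... | inj₁ (refl , refl) = _ , ≤-refl , ≤-refl , te , typed-letter _
    ... | inj₂ (_ , ())
    detect-sound (suc n) {e = e} {t} nothing i<j te refl eq with if-equal-just _ t e _ eq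
    ... | inj₁ (refl , refl) = _ , ≤-refl , ≤-refl , te , typed-letter _
    ... | inj₂ (_ , ())
    detect-sound (suc n) {e = e} {t} (just (u , us)) i<j te sg@(j′ , _ , j<j′ , tu , sg′) eq
      with if-equal-just _ t e _ eq
    ... | inj₁ (refl , refl) =
      _ , ≤-refl , segmented-≤ (suc n) (just (u , us)) sg , te , product-typed (suc n) (just (u , us)) sg
    ... | inj₂ (_ , eq′) =
      let l , j′≤l , rest = detect-sound n us (<-trans i<j j<j′) (typed-⊙ i<j j<j′ te tu) sg′ eq′ in
      l , ≤-trans (<⇒≤ j<j′) j′≤l , rest

    step-segmented : ∀ n R {b i m} us → b ≤ suc m → Segmented n b i m us → ¬ NoEvent n us (a m) →
                     Segmented n b i (suc m) (proj₁ (step n R us (a m)))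
    resolve-segmented :
      ∀ n R {b i m} u us d → b ≤ suc m → Segmented (suc n) b i m (just (u , us)) →
      (d ≡ nothing → ¬ NoEvent n us (a m)) →
      Segmented (suc n) b i (suc m) (proj₁ (resolve n R u us (a m) d))
    step-segmented zero    R us              b≤ sg   ev = ⊥-elim (ev tt)
    step-segmented (suc n) R {m = m} nothing b≤ refl ev =
      suc m , b≤ , ≤-refl , typed-letter m , segmented-empty n
    step-segmented (suc n) R (just (u , us)) b≤ sg   ev =
      resolve-segmented n R u us (detect n u _ us _) b≤ sg λ eq ne → ev (eq , ne)
    resolve-segmented n R {m = m} u us (just e) b≤ sg ev =
      suc m , b≤ , s≤s (segmented-≤ (suc n) (just (u , us)) sg) ,
      product-typed (suc n) (just (u , us)) sg , segmented-empty n
    resolve-segmented n R u us nothing b≤ (j , b≤j , i<j , t , sg) ev =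
      j , b≤j , i<j , t , step-segmented n (image R u) us z≤n sg (ev refl)

  module Classical (em : ∀ {P : Set} → Dec P) (q₀ : Q) where
    open Logic em
    open From q₀

    Fin-bounded : ∀ {n} (f : Fin n → ℕ) → ∃[ N ] ∀ i → f i ≤ N
    Fin-bounded {zero}  f = 0 , λ ()
    Fin-bounded {suc n} f =
      let N , f≤N = Fin-bounded (f ∘ suc) in
      f zero ⊔ N , λ { zero → m≤m⊔n _ N ; (suc i) → ≤-trans (f≤N i) (m≤n⊔m (f zero) N) }

    infinite-pigeonhole : ∀ {A : Set} → Finite A → {P : A → ℕ → Set} →
                          (∀ {x m n} → m ≤ n → P x n → P x m) →
                          (∀ n → ∃[ x ] P x n) → ∃[ x ] ∀ n → P x n
    infinite-pigeonhole F {P} mono some = dne λ none →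
      let fails : ∀ x → ∃[ n ] ¬ P x n
          fails x = ¬∀⇒∃¬ λ all → none (x , all)
          N , ≤N = Fin-bounded (proj₁ ∘ fails ∘ dec F)
          x , p = some N
          x′ = dec F (enc F x)
      in proj₂ (fails x′) (mono (≤N (enc F x)) (subst (λ x → P x N) (sym (dec-enc F x)) p))

    Outcome : ∀ {k} → (ℕ → Fin k) → Set
    Outcome pr = ∃[ b ] Parity b (toℕ ∘ pr) × ∃[ R ] ∃[ e ] Factorisation R e × accepts R e ≡ b

    -- A run of the last `n` slots alone from time `m₀` on, where `R` holds the states reachable at
    -- the start `i` of their first segment. This is what remains once the earlier slots have
    -- stopped reporting.
    record Run (n : ℕ) (R : States) (i m₀ : ℕ) (st : ℕ → Slots n)
               (pr : ℕ → Fin (priorities n)) : Set where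
      field
        prefix    : Prefix i R
        segmented : Segmented n 0 i m₀ (st m₀)
        events    : ∀ m → m₀ ≤ m → ¬ NoEvent n (st m) (a m)
        state     : ∀ m → m₀ ≤ m → st (suc m) ≡ proj₁ (step n R (st m) (a m))
        priority  : ∀ m → m₀ ≤ m → pr m ≡ proj₂ (step n R (st m) (a m))

      segmented-from : ∀ {b m₁} → m₀ ≤ m₁ → b ≤ suc m₁ → Segmented n b i m₁ (st m₁) →
                       ∀ m → m₁ ≤ m → Segmented n b i m (st m)
      segmented-from {b} {m₁} m₀≤m₁ b≤ sg m m₁≤m =
        subst (λ m → Segmented n b i m (st m)) (m∸n+n≡m m₁≤m) (go (m ∸ m₁))
        where
        go : ∀ d → Segmented n b i (d + m₁) (st (d + m₁))
        go zero    = sg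
        go (suc d) = subst (Segmented n b i (suc (d + m₁))) (sym (state _ m₀≤))
          (step-segmented n R (st (d + m₁)) (≤-trans b≤ (s≤s (m≤n+m m₁ d))) (go d) (events _ m₀≤))
          where m₀≤ = ≤-trans m₀≤m₁ (m≤n+m m₁ d)

    Hit : ℕ → Table → ℕ → Set
    Hit i e N = ∃[ j ] ∃[ m ] ∃[ v ]
      N ≤ j × j ≤ m × i < j × Typed i j e × Typed i (suc m) v × Typed j (suc m) v

    -- At a hit the segments from `i` and from `j` have the same type, and by `typed-transfer` this
    -- persists. The segment between two slots therefore has the type of the one from `i` to the
    -- later slot, which is `e`. Each slot is chosen beyond the end of the previous hit to make this
    -- applicable.
    hits-factorisation : ∀ {i R e} → Prefix i R → (∀ N → Hit i e N) → Factorisation R e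
    hits-factorisation {i} {R} {e} p hits =
      i , p , slot , typed , later
      where
      bound : ℕ → ℕ
      slot : ℕ → ℕ
      bound zero    = 0
      bound (suc n) = let _ , m , _ = hits (bound n) in suc m
      slot n        = proj₁ (hits (bound n))
      typed : ∀ n → i < slot n × Typed i (slot n) e
      typed n = let _ , _ , _ , _ , _ , i<j , t , _ = hits (bound n) in i<j , t
      bound≤slot : ∀ n → bound n ≤ slot n
      bound≤slot n = let _ , _ , _ , le , _ = hits (bound n) in le
      slot<bound : ∀ n → slot n < bound (suc n)
      slot<bound n = let _ , _ , _ , _ , le , _ = hits (bound n) in s≤s le
      bound-mono : ∀ {n n′} → n ≤′ n′ → bound n ≤ bound n′
      bound-mono ≤′-refl = ≤-refl
      bound-mono (≤′-step {n} le) =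
        ≤-trans (bound-mono le) (≤-trans (bound≤slot n) (<⇒≤ (slot<bound n)))
      later : ∀ {n n′} → n < n′ → slot n < slot n′ × Typed (slot n) (slot n′) e
      later {n} {n′} n<n′ =
        let _ , _ , _ , _ , _ , i<j , _ , tᵢ , tⱼ = hits (bound n)
            le = ≤-trans (bound-mono (≤⇒≤′ n<n′)) (bound≤slot n′)
        in <-≤-trans (slot<bound n) le ,
           typed-transfer (<-trans i<j (slot<bound n)) (slot<bound n) le tᵢ tⱼ (proj₂ (typed n′))

    verdict-injective : ∀ {k b b′} → verdict {k} b ≡ verdict b′ → b ≡ b′
    verdict-injective {b = true}  {true}  _ = refl
    verdict-injective {b = false} {false} _ = refl

    step-just : ∀ n R us x → ∃[ y ] proj₁ (step (suc n) R us x) ≡ just y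
    step-just n R nothing x = _ , refl
    step-just n R (just (u , us)) x = resolve-just (detect n u _ us x)
      where
      resolve-just : ∀ d → ∃[ y ] proj₁ (resolve n R u us x d) ≡ just y
      resolve-just (just _) = _ , refl
      resolve-just nothing  = _ , refl

    module FirstSlot (n : ℕ) {R i m₀ st pr} (run : Run (suc n) R i m₀ st pr) where
      open Run run

      data View (m : ℕ) : Set where
        hit  : ∀ u us e → st m ≡ just (u , us) →
               detect n u (u ⊙ product n us (a m)) us (a m) ≡ just e →
               st (suc m) ≡ just (u ⊙ product n us (a m) , empty n) →
               pr m ≡ verdict (accepts R e) → View m
        miss : ∀ u us → st m ≡ just (u , us) →
               detect n u (u ⊙ product n us (a m)) us (a m) ≡ nothing →
               st (suc m) ≡ just (u , proj₁ (step n (image R u) us (a m))) →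
               pr m ≡ suc (suc (proj₂ (step n (image R u) us (a m)))) → View m

      just-at : ∀ {m} → m₀ < m → ∃[ y ] st m ≡ just y
      just-at {suc m} (s≤s m₀≤m) =
        let y , eq = step-just n R (st m) (a m) in y , trans (state m m₀≤m) eq

      view : ∀ {m} → m₀ < m → View m
      view {m} m₀<m with just-at m₀<m
      ... | (u , us) , eq = by-detection (detect n u (u ⊙ product n us (a m)) us (a m)) refl
        where
        stepped : ∀ {d} → detect n u (u ⊙ product n us (a m)) us (a m) ≡ d →
                  step (suc n) R (st m) (a m) ≡ resolve n R u us (a m) d
        stepped deq = trans (cong (λ s → step (suc n) R s (a m)) eq) (cong (resolve n R u us (a m)) deq)
        by-detection : ∀ d → detect n u (u ⊙ product n us (a m)) us (a m) ≡ d → View m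
        by-detection (just e) deq =
          hit u us e eq deq (trans (state m (<⇒≤ m₀<m)) (cong proj₁ (stepped deq)))
                            (trans (priority m (<⇒≤ m₀<m)) (cong proj₂ (stepped deq)))
        by-detection nothing deq =
          miss u us eq deq (trans (state m (<⇒≤ m₀<m)) (cong proj₁ (stepped deq)))
                           (trans (priority m (<⇒≤ m₀<m)) (cong proj₂ (stepped deq)))

      segmented-at : ∀ m → m₀ ≤ m → Segmented (suc n) 0 i m (st m)
      segmented-at = segmented-from ≤-refl z≤n segmented

      after-hit : ∀ {c m} → m₀ < m → pr m ≡ verdict c → Segmented (suc n) (suc m) i (suc m) (st (suc m))
      after-hit {c} {m} m₀<m pr≡ with view m₀<m
      ... | hit u us e eq _ eq′ _ =
        let sg = subst (Segmented (suc n) 0 i m) eq (segmented-at m (<⇒≤ m₀<m)) in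
        subst (Segmented (suc n) (suc m) i (suc m)) (sym eq′)
          (suc m , ≤-refl , s≤s (segmented-≤ (suc n) (just (u , us)) sg) ,
           product-typed (suc n) (just (u , us)) sg , segmented-empty n)
      after-hit {true}  _ pr≡ | miss _ _ _ _ _ pr≡′ with () ← trans (sym pr≡) pr≡′
      after-hit {false} _ pr≡ | miss _ _ _ _ _ pr≡′ with () ← trans (sym pr≡) pr≡′

      hit-after : ∀ {c b m} → m₀ < m → pr m ≡ verdict c → Segmented (suc n) b i m (st m) →
                  ∃[ e ] accepts R e ≡ c × Hit i e b
      hit-after {c} {b} {m} m₀<m pr≡ sg with view m₀<m
      ... | hit u us e eq deq _ pr≡′ =
        let sg′@(j , b≤j , i<j , tu , sgⱼ) = subst (Segmented (suc n) b i m) eq sg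
            l , j≤l , l≤m , te , tl = detect-sound n us i<j tu sgⱼ deq
        in e , verdict-injective (trans (sym pr≡′) pr≡) ,
           l , m , _ , ≤-trans b≤j j≤l , l≤m , <-≤-trans i<j j≤l , te ,
           product-typed (suc n) (just (u , us)) sg′ , tl
      hit-after {true}  _ pr≡ _ | miss _ _ _ _ _ pr≡′ with () ← trans (sym pr≡) pr≡′
      hit-after {false} _ pr≡ _ | miss _ _ _ _ _ pr≡′ with () ← trans (sym pr≡) pr≡′

      factorisation : ∀ c → Infinitely (λ m → pr m ≡ verdict c) →
                      ∃[ R ] ∃[ e ] Factorisation R e × accepts R e ≡ c
      factorisation c inf =
        let e , hits = infinite-pigeonhole finite-Table {λ e N → accepts R e ≡ c × Hit i e N}
              (λ { N≤N′ (eq , j , m , v , N′≤j , rest) → eq , j , m , v , ≤-trans N≤N′ N′≤j , rest }) hits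
        in R , e , hits-factorisation prefix (proj₂ ∘ hits) , proj₁ (hits 0)
        where
        hits : ∀ N → ∃[ e ] accepts R e ≡ c × Hit i e N
        hits N =
          -- Two reports give one hit: the first makes the first segment end after `N`, so the slot
          -- found by the second lies beyond `N`.
          let m₁ , le₁ , pr₁ = inf (N ⊔ suc m₀)
              m₀<m₁ = ≤-trans (m≤n⊔m N (suc m₀)) le₁
              m₂ , le₂ , pr₂ = inf (suc m₁)
              m₀<m₂ = <-trans m₀<m₁ le₂
              e , eq , j , m , v , le , rest = hit-after m₀<m₂ pr₂
                (segmented-from (<⇒≤ (<-trans m₀<m₁ ≤-refl)) (n≤1+n _) (after-hit m₀<m₁ pr₁) m₂ le₂)
          in e , eq , j , m , v ,
             ≤-trans (≤-trans (m≤m⊔n N (suc m₀)) (≤-trans le₁ (n≤1+n m₁))) le , rest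

    -- If the first slot reports infinitely often, its reports give the factorisation and the least
    -- priority. Otherwise its segment `u` is frozen from some time `M` on, and the remaining slots
    -- form a run over the states reached after `u`, with priorities shifted by two.
    outcome : ∀ n {R i m₀ st pr} → Run n R i m₀ st pr → Outcome pr
    outcome zero run = ⊥-elim (Run.events run _ ≤-refl tt)
    outcome (suc n) {R} {i} {m₀} {st} {pr} run
      with em {Infinitely (λ m → pr m ≡ zero)} | em {Infinitely (λ m → pr m ≡ suc zero)}
    ... | yes inf | _ =
      true , (0 , refl , (0 , λ _ _ → z≤n) , λ N → let m , le , eq = inf N in m , le , cong toℕ eq) ,
      FirstSlot.factorisation n run true inf
    ... | no ¬inf | yes inf =
      false ,
      (1 , refl , (let N , ≢0 = ¬infinitely ¬inf in N , λ m le → positive (pr m) (≢0 m le)) ,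
       λ N → let m , le , eq = inf N in m , le , cong toℕ eq) ,
      FirstSlot.factorisation n run false inf
      where
      positive : ∀ {k} (x : Fin (suc k)) → x ≢ zero → 1 ≤ toℕ x
      positive zero    ≢0 = ⊥-elim (≢0 refl)
      positive (suc x) _  = s≤s z≤n
    ... | no ¬inf₀ | no ¬inf₁ =
      let b , par , rest = outcome n inner in b , shift b par , rest
      where
      open FirstSlot n run
      open Run run
      M₀ = ¬infinitely ¬inf₀ .proj₁
      M₁ = ¬infinitely ¬inf₁ .proj₁
      M = suc m₀ ⊔ (M₀ ⊔ M₁)
      m₀<M : m₀ < M
      m₀<M = m≤m⊔n (suc m₀) (M₀ ⊔ M₁)
      u : Table
      u = proj₁ (proj₁ (just-at m₀<M))
      later-slots : Slots (suc n) → Slots n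
      later-slots nothing         = empty n
      later-slots (just (_ , us)) = us
      R′ = image R u
      st′ : ℕ → Slots n
      st′ m = later-slots (st m)
      pr′ : ℕ → Fin (priorities n)
      pr′ m = proj₂ (step n R′ (st′ m) (a m))
      Miss : ℕ → Set
      Miss m = detect n u (u ⊙ product n (st′ m) (a m)) (st′ m) (a m) ≡ nothing ×
               st (suc m) ≡ just (u , proj₁ (step n R′ (st′ m) (a m))) × pr m ≡ suc (suc (pr′ m))
      miss-at : ∀ m → M ≤ m → st m ≡ just (u , st′ m) → Miss m
      miss-at m M≤m st≡ with view (<-≤-trans m₀<M M≤m)
      ... | hit _ _ e _ _ _ pr≡ = ⊥-elim (no-verdict (accepts R e) pr≡)
        where
        no-verdict : ∀ b → pr m ≢ verdict b
        no-verdict true  = ¬infinitely ¬inf₀ .proj₂ m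
          (≤-trans (≤-trans (m≤m⊔n M₀ M₁) (m≤n⊔m (suc m₀) _)) M≤m)
        no-verdict false = ¬infinitely ¬inf₁ .proj₂ m
          (≤-trans (≤-trans (m≤n⊔m M₀ M₁) (m≤n⊔m (suc m₀) _)) M≤m)
      ... | miss v vs st≡′ deq eq pr≡ with trans (sym st≡) st≡′
      ...   | eq′ = subst (λ { (u , us) → detect n u (u ⊙ product n us (a m)) us (a m) ≡ nothing ×
                         st (suc m) ≡ just (u , proj₁ (step n (image R u) us (a m))) ×
                         pr m ≡ suc (suc (proj₂ (step n (image R u) us (a m)))) })
                      (just-injective (sym eq′)) (deq , eq , pr≡)
      st-at : ∀ d → st (d + M) ≡ just (u , st′ (d + M))
      st-at zero = let (_ , us) , eq = just-at m₀<M in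
        trans eq (cong (λ us → just (u , us)) (sym (cong later-slots eq)))
      st-at (suc d) = let _ , eq , _ = miss-at (d + M) (m≤n+m M d) (st-at d) in
        trans eq (cong (λ us → just (u , us)) (sym (cong later-slots eq)))
      st-from : ∀ m → M ≤ m → st m ≡ just (u , st′ m)
      st-from m M≤m = subst (λ m → st m ≡ just (u , st′ m)) (m∸n+n≡m M≤m) (st-at (m ∸ M))
      misses : ∀ m → M ≤ m → Miss m
      misses m M≤m = miss-at m M≤m (st-from m M≤m)
      head : Segmented (suc n) 0 i M (just (u , st′ M))
      head = subst (Segmented (suc n) 0 i M) (st-from M ≤-refl) (segmented-at M (<⇒≤ m₀<M))
      inner : Run n R′ (proj₁ head) M st′ pr′
      inner = let j , _ , i<j , tu , sg = head in record
        { prefix    = prefix-image i<j prefix tu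
        ; segmented = sg
        ; events    = λ m M≤m ne → events m (≤-trans (<⇒≤ m₀<M) M≤m)
            (subst (λ s → NoEvent (suc n) s (a m)) (sym (st-from m M≤m)) (proj₁ (misses m M≤m) , ne))
        ; state     = λ m M≤m → cong later-slots (proj₁ (proj₂ (misses m M≤m)))
        ; priority  = λ _ _ → refl }
      shift : ∀ b → Parity b (toℕ ∘ pr′) → Parity b (toℕ ∘ pr)
      shift b par = parity-undrop M (parity-cong
        (λ d → cong toℕ (sym (proj₂ (proj₂ (misses (M + d) (m≤m+n M d))))))
        (parity-drop M (subst (λ b → Parity b _) (not-involutive b) (parity-suc (parity-suc par)))))

-- Odd traces and odd lassos of a factorised word

⊓ᶠ-sel : ∀ {n} (i j : Fin n) → i ⊓ᶠ j ≡ i ⊎ i ⊓ᶠ j ≡ j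
⊓ᶠ-sel i j with ≤-total (toℕ i) (toℕ j)
... | inj₁ _ = inj₁ refl
... | inj₂ _ = inj₂ refl

⊓ᶠ-≤ˡ : ∀ {n} (i j : Fin n) → toℕ (i ⊓ᶠ j) ≤ toℕ i
⊓ᶠ-≤ˡ i j = ≤-trans (≤-reflexive (toℕ-⊓ᶠ i j)) (m⊓n≤m (toℕ i) (toℕ j))

⊓ᶠ-≤ʳ : ∀ {n} (i j : Fin n) → toℕ (i ⊓ᶠ j) ≤ toℕ j
⊓ᶠ-≤ʳ i j = ≤-trans (≤-reflexive (toℕ-⊓ᶠ i j)) (m⊓n≤n (toℕ i) (toℕ j))

⊓ᶠ-glb : ∀ {n l} (i j : Fin n) → l ≤ toℕ i → l ≤ toℕ j → l ≤ toℕ (i ⊓ᶠ j)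
⊓ᶠ-glb i j l≤i l≤j = subst (_ ≤_) (sym (toℕ-⊓ᶠ i j)) (⊓-glb l≤i l≤j)

module Correct {Q : Set} (finite-Q : Finite Q) (K : ℕ)
               (a : ℕ → Determinisation.Table finite-Q K)
               (em : ∀ {P : Set} → Dec P) (q₀ : Q) where
  open Determinisation finite-Q K
  open Word finite-Q K a
  open From q₀
  open Classical em q₀
  open Logic em
  open Typed
  open Prefix

  IsTrace : (ℕ → Q) → (ℕ → Fin K) → Set
  IsTrace π κ = π 0 ≡ q₀ × (∀ n → π n -[ a n , κ n ]→ π (suc n))

  OddTrace : Set
  OddTrace = ∃[ π ] ∃[ κ ] IsTrace π κ × Parity false (toℕ ∘ κ)

  module Unroll {g : ℕ → ℕ} {q k k₀} (initial : Trace 0 (g 0) q₀ k₀ q)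
                (loop : ∀ n → Trace (g n) (g (suc n)) q k q) where

    record Configuration (m : ℕ) : Set where
      constructor configuration
      field
        checkpoint : ℕ
        {end}      : ℕ
        {state}    : Q
        {minimum}  : Fin K
        todo       : Trace m end state minimum q
        end≡       : end ≡ g checkpoint
        low        : checkpoint ≡ 0 ⊎ toℕ k ≤ toℕ minimum
    open Configuration

    fresh : ∀ n j → j ≡ g n → Configuration j
    fresh n j eq = configuration (suc n)
      (subst (λ j → Trace j (g (suc n)) q k q) (sym eq) (loop n)) refl (inj₂ ≤-refl)

    weaken : ∀ {n i} (j l : Fin K) → i ≡ j ⊓ᶠ l → n ≡ 0 ⊎ toℕ k ≤ toℕ i → n ≡ 0 ⊎ toℕ k ≤ toℕ l
    weaken j l eq (inj₁ n≡0) = inj₁ n≡0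
    weaken j l refl (inj₂ le) = inj₂ (≤-trans le (⊓ᶠ-≤ʳ j l))

    advance : ∀ {m} → Configuration m → Configuration (suc m)
    advance (configuration n (one _) eq low)          = fresh n _ eq
    advance (configuration n (cons {k = κ} {κ′} _ tr min≡) eq low) = configuration n tr eq (weaken κ κ′ min≡ low)

    letter : ∀ {m} → Configuration m → Fin K
    letter (configuration _ (one {k = κ} _) _ _)      = κ
    letter (configuration _ (cons {k = κ} _ _ _) _ _) = κ

    edge : ∀ {m} (c : Configuration m) → state c -[ a m , letter c ]→ state (advance c)
    edge (configuration _ (one x) _ _)      = x
    edge (configuration _ (cons x _ _) _ _) = x

    letter-≥ : ∀ {m} (c : Configuration m) → toℕ (minimum c) ≤ toℕ (letter c)
    letter-≥ (configuration _ (one _) _ _)                  = ≤-refl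
    letter-≥ (configuration _ (cons {k = κ} {κ′} _ _ refl) _ _) = ⊓ᶠ-≤ˡ κ κ′

    checkpoint-mono : ∀ {m} (c : Configuration m) → checkpoint c ≤ checkpoint (advance c)
    checkpoint-mono (configuration n (one _) _ _)      = n≤1+n n
    checkpoint-mono (configuration n (cons _ _ _) _ _) = ≤-refl

    run : ∀ m → Configuration m
    run zero    = configuration 0 initial refl (inj₁ refl)
    run (suc m) = advance (run m)

    reaches-checkpoint : ∀ {m j p l} n (tr : Trace m j p l q) eq low → run m ≡ configuration n tr eq low →
                         ∃[ m′ ] m < m′ × ∃[ eq′ ] run m′ ≡ fresh n m′ eq′
    reaches-checkpoint n (one _) eq low is = _ , ≤-refl , eq , cong advance is
    reaches-checkpoint n (cons {k = κ} {κ′} _ tr min≡) eq low is =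
      let m′ , lt , rest = reaches-checkpoint n tr eq (weaken κ κ′ min≡ low) (cong advance is) in
      m′ , <-trans (n<1+n _) lt , rest

    reaches-minimum : ∀ {m j p l} n (tr : Trace m j p l q) eq low → run m ≡ configuration n tr eq low →
                      ∃[ m′ ] m ≤ m′ × letter (run m′) ≡ l
    reaches-minimum n (one _) eq low is = _ , ≤-refl , cong letter is
    reaches-minimum n (cons {k = κ} {κ′} _ tr refl) eq low is with ⊓ᶠ-sel κ κ′
    ... | inj₁ min≡ = _ , ≤-refl , trans (cong letter is) (sym min≡)
    ... | inj₂ min≡ =
      let m′ , le , eq′ = reaches-minimum n tr eq (weaken κ κ′ refl low) (cong advance is) in
      m′ , ≤-trans (n≤1+n _) le , trans eq′ (sym min≡)

    checkpoint-after : ∀ m → ∃[ n ] ∃[ m′ ] m < m′ × ∃[ eq′ ] run m′ ≡ fresh n m′ eq′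
    checkpoint-after m with run m in is
    ... | configuration n tr eq low = n , reaches-checkpoint n tr eq low is

    eventually-≥ : Eventually (λ m → toℕ k ≤ toℕ (letter (run m)))
    eventually-≥ =
      let n , M , _ , eq , is = checkpoint-after 0
          positive = λ d → ≤-trans (subst (λ c → 1 ≤ checkpoint c) (sym is) (s≤s z≤n)) (mono M d)
      in M , λ m M≤m → subst (λ m → toℕ k ≤ toℕ (letter (run m))) (m∸n+n≡m M≤m)
           (≤-trans (above (run (m ∸ M + M)) (positive (m ∸ M))) (letter-≥ (run (m ∸ M + M))))
      where
      mono : ∀ M d → checkpoint (run M) ≤ checkpoint (run (d + M))
      mono M zero    = ≤-refl
      mono M (suc d) = ≤-trans (mono M d) (checkpoint-mono (run (d + M)))
      above : ∀ {m} (c : Configuration m) → 1 ≤ checkpoint c → toℕ k ≤ toℕ (minimum c)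
      above c pos with low c
      ... | inj₂ le  = le
      ... | inj₁ eq with () ← subst (1 ≤_) eq pos

    infinitely-≡ : Infinitely (λ m → toℕ (letter (run m)) ≡ toℕ k)
    infinitely-≡ N =
      let n , M , N<M , eq , is = checkpoint-after N
          m , M≤m , eq′ = reaches-minimum (suc n) _ refl (inj₂ ≤-refl) is
      in m , ≤-trans (<⇒≤ N<M) M≤m , cong toℕ eq′

    odd-trace : even (toℕ k) ≡ false → OddTrace
    odd-trace odd = (λ m → state (run m)) , (λ m → letter (run m)) , (refl , λ m → edge (run m)) ,
                    toℕ k , odd , eventually-≥ , infinitely-≡

  lasso⇒odd-trace : ∀ {R e} → Factorisation R e → OddLasso R e → OddTrace
  lasso⇒odd-trace (i , p , g , typed , later) ((q₁ , k₁ , q , k) , r , x , y , odd) =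
    let _ , initial = reach-trace (p .∈⇒reach r) (proj₂ (typed 0) .∈⇒trace x) in
    Unroll.odd-trace {g} initial (λ n → later ≤-refl .proj₂ .∈⇒trace y) (Equivalence.to T-not-≡ odd)

  module _ {π κ} (is-trace : IsTrace π κ) where

    reached : ∀ i → Reach i (π i)
    reached zero    = subst (Reach 0) (sym (proj₁ is-trace)) start
    reached (suc i) = move (reached i) (proj₂ is-trace i)

    Segment : ℕ → ℕ → Set
    Segment i j = ∃[ k ] Trace i j (π i) k (π j) ×
      (∀ {l} → (∀ m → i ≤ m → l ≤ toℕ (κ m)) → l ≤ toℕ k) ×
      (∀ m → i ≤ m → m < j → toℕ k ≤ toℕ (κ m))

    segment : ∀ {i j} → i < j → Segment i j
    segment {i} {j} i<j = subst (Segment i) (trans (sym (+-suc _ i)) (m∸n+n≡m i<j)) (go (j ∸ suc i) i)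
      where
      go : ∀ d i → Segment i (suc (d + i))
      go zero i = κ i , one (proj₂ is-trace i) , (λ lb → lb i ≤-refl) ,
        λ m i≤m m≤i → ≤-reflexive (cong (toℕ ∘ κ) (≤-antisym i≤m (s≤s⁻¹ m≤i)))
      go (suc d) i with go d (suc i)
      ... | k , tr , glb , lb rewrite +-suc d i =
        κ i ⊓ᶠ k , cons (proj₂ is-trace i) tr refl ,
        (λ lb′ → ⊓ᶠ-glb (κ i) k (lb′ i ≤-refl) (glb λ m le → lb′ m (<⇒≤ le))) ,
        lower
        where
        lower : ∀ m → i ≤ m → m < suc (suc (d + i)) → toℕ (κ i ⊓ᶠ k) ≤ toℕ (κ m)
        lower m i≤m m<j with m≤n⇒m<n∨m≡n i≤m
        ... | inj₂ refl = ⊓ᶠ-≤ˡ (κ i) k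
        ... | inj₁ i<m  = ≤-trans (⊓ᶠ-≤ʳ (κ i) k) (lb m i<m m<j)

    -- Some state `q` recurs at the cut points. The loop is taken between two visits, the first
    -- after the priorities have settled at `l` or above, the second after a further occurrence of
    -- `l`; its least priority is then `l`.
    odd-trace⇒lasso : ∀ {R e} → Factorisation R e → Parity false (toℕ ∘ κ) → OddLasso R e
    odd-trace⇒lasso {R} {e} (i , p , g , typed , later) (l , odd , (N , l≤) , inf) =
      (π i , proj₁ seg₁ , q , proj₁ seg₂) , p .reach⇒∈ (reached i) ,
      subst (λ q′ → π i -[ e , proj₁ seg₁ ]→ q′) at₁ (proj₂ (typed n₁) .trace⇒∈ (proj₁ (proj₂ seg₁))) ,
      subst₂ (λ q′ q″ → q′ -[ e , proj₁ seg₂ ]→ q″) at₁ at₂ (later n₁<n₂ .proj₂ .trace⇒∈ (proj₁ (proj₂ seg₂))) ,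
      Equivalence.from T-not-≡ (trans (cong even k≡l) odd)
      where
      g-≥ : ∀ n → n ≤ g n
      g-≥ zero    = z≤n
      g-≥ (suc n) = ≤-trans (s≤s (g-≥ n)) (later (n<1+n n) .proj₁)
      recurrent : ∃[ q ] ∀ N → ∃[ n ] N ≤ n × π (g n) ≡ q
      recurrent = infinite-pigeonhole finite-Q
        (λ { M≤N (n , N≤n , eq) → n , ≤-trans M≤N N≤n , eq }) (λ N → π (g N) , N , ≤-refl , refl)
      q = proj₁ recurrent
      visit₁ = proj₂ recurrent N
      n₁ = proj₁ visit₁
      at₁ : π (g n₁) ≡ q
      at₁ = proj₂ (proj₂ visit₁)
      low = inf (g n₁)
      m = proj₁ low
      visit₂ = proj₂ recurrent (suc m)
      n₂ = proj₁ visit₂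
      at₂ : π (g n₂) ≡ q
      at₂ = proj₂ (proj₂ visit₂)
      m<n₂ : m < n₂
      m<n₂ = proj₁ (proj₂ visit₂)
      n₁<n₂ : n₁ < n₂
      n₁<n₂ = ≤-<-trans (≤-trans (g-≥ n₁) (proj₁ (proj₂ low))) m<n₂
      N≤gn₁ : N ≤ g n₁
      N≤gn₁ = ≤-trans (proj₁ (proj₂ visit₁)) (g-≥ n₁)
      seg₁ = segment (proj₁ (typed n₁))
      seg₂ = segment (later n₁<n₂ .proj₁)
      k≡l : toℕ (proj₁ seg₂) ≡ l
      k≡l = ≤-antisym
        (≤-trans (proj₂ (proj₂ (proj₂ seg₂)) m (proj₁ (proj₂ low)) (<-≤-trans m<n₂ (g-≥ n₂)))
                 (≤-reflexive (proj₂ (proj₂ low))))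
        (proj₁ (proj₂ (proj₂ seg₂)) (λ m le → l≤ m (≤-trans N≤gn₁ le)))

  prefix-singleton : Prefix 0 (singleton q₀)
  prefix-singleton .∈⇒reach x with refl ← ∈⟪⟫⁻ finite-Q (λ q → _≟_ finite-Q q q₀) x = start
  prefix-singleton .reach⇒∈ start = ∈⟪⟫⁺ finite-Q (λ q → _≟_ finite-Q q q₀) refl

  accepts-correct : ∀ R e b → Factorisation R e → accepts R e ≡ b →
                    (b ≡ true → ¬ OddTrace) × (b ≡ false → OddTrace)
  accepts-correct R e b fact eq with oddLasso? R e
  accepts-correct R e false fact _ | yes lasso = (λ ()) , λ _ → lasso⇒odd-trace fact lasso
  accepts-correct R e true  fact _ | no ¬lasso =
    (λ _ (π , κ , tr , odd) → ¬lasso (odd-trace⇒lasso tr fact odd)) , λ ()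

  module _ (st : ℕ → Slots capacity) (pr : ℕ → Fin (priorities capacity)) (st₀ : st 0 ≡ empty capacity)
           (st-step : ∀ m → st (suc m) ≡ proj₁ (step capacity (singleton q₀) (st m) (a m)))
           (pr-step : ∀ m → pr m ≡ proj₂ (step capacity (singleton q₀) (st m) (a m))) where

    deterministic-run : Run capacity (singleton q₀) 0 0 st pr
    deterministic-run = record
      { prefix    = prefix-singleton
      ; segmented = subst (Segmented capacity 0 0 0) (sym st₀) (segmented-empty capacity {0} {0})
      ; events    = λ m _ → event (st m) (a m)
      ; state     = λ m _ → st-step m
      ; priority  = λ m _ → pr-step m }

    no-odd-trace⇒even : ¬ OddTrace → Parity true (toℕ ∘ pr)
    no-odd-trace⇒even none with outcome capacity deterministic-run
    ... | true  , par , _ = par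
    ... | false , _ , R , e , fact , eq = ⊥-elim (none (accepts-correct R e false fact eq .proj₂ refl))

    even⇒no-odd-trace : Parity true (toℕ ∘ pr) → ¬ OddTrace
    even⇒no-odd-trace par with outcome capacity deterministic-run
    ... | true  , _ , R , e , fact , eq = accepts-correct R e true fact eq .proj₁ refl
    ... | false , par′ , _ = λ _ → parity-exclusive par par′

-- Alternating tree automata

-- Together with `code-list` this numbers the positions of an infinite arena, as the merging of
-- strategies in `Determinacy` requires.
pairing : ∀ {n} → Fin n → ℕ → ℕ
pairing {n} i c = toℕ i + c * n

pairing-injective : ∀ {n} (i j : Fin n) {c d} → pairing i c ≡ pairing j d → i ≡ j × c ≡ d
pairing-injective {suc n} i j {c} {d} eq = i≡j , c≡d
  where
  remainder : ∀ (i : Fin (suc n)) c → pairing i c % suc n ≡ toℕ i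
  remainder i c = trans ([m+kn]%n≡m%n (toℕ i) c (suc n)) (m<n⇒m%n≡m (Fin.toℕ<n i))
  i≡j : i ≡ j
  i≡j = Fin.toℕ-injective (trans (sym (remainder i c)) (trans (cong (_% suc n) eq) (remainder j d)))
  c≡d : c ≡ d
  c≡d = *-cancelʳ-≡ c d (suc n) (+-cancelˡ-≡ (toℕ i) (c * suc n) (d * suc n)
          (trans eq (cong (λ k → toℕ k + d * suc n) (sym i≡j))))

code-list : ∀ {n} → List (Fin n) → ℕ
code-list []      = 0
code-list (v ∷ w) = suc (pairing v (code-list w))

code-list-injective : ∀ {n} (w w′ : List (Fin n)) → code-list w ≡ code-list w′ → w ≡ w′
code-list-injective []      []        _  = refl
code-list-injective (v ∷ w) (v′ ∷ w′) eq with pairing-injective v v′ (suc-injective eq)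
... | refl , eq′ = cong (v ∷_) (code-list-injective w w′ eq′)

-- Alternating parity automata on trees with directions V, whose nodes are
-- addressed by the reversed list of directions leading to them.  In one round
-- the player picks c, the opponent picks b, and the run descends one level.
module Automata (Λ : Set) {nV : ℕ} (v₀ : Fin nV) where

  V : Set
  V = Fin nV

  Tree : Set
  Tree = List V → Λ

  record Automaton : Set₁ where
    field
      {Q C B}  : Set
      finite-Q : Finite Q
      finite-C : Finite C
      finite-B : Finite B
      c₀       : C
      b₀       : B
      {K}      : ℕ
      Ω        : Q → Fin K
      δ        : Q → Λ → C → B → Q × V
      -- The start state carries the current position, because `δ` sees the label but not the
      -- address.
      initial  : V → Q

    arena : Tree → Game (Q × List V)
    arena t = record
      { C = C ; B = B ; c₀ = c₀ ; b₀ = b₀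
      ; next = λ (q , w) c b → let q′ , v = δ q (t w) c b in q′ , v ∷ w
      ; Ω = λ (q , w) → toℕ (Ω q) }

    Accepts : Tree → Q → List V → Set
    Accepts t q w = Win (arena t) (q , w)

    Recognises : Tree → V → List V → Set
    Recognises t v w = Accepts t (initial v) w

    code : Q × List V → ℕ
    code (q , w) = pairing (enc finite-Q q) (code-list w)

    code-injective : ∀ {x y} → code x ≡ code y → x ≡ y
    code-injective {q , w} {q′ , w′} eq =
      let i≡j , c≡d = pairing-injective (enc finite-Q q) (enc finite-Q q′) eq in
      cong₂ _,_ (enc-injective finite-Q i≡j) (code-list-injective w w′ c≡d)

  open Automaton

  atomic : (V → Bool) → Automaton
  atomic p = record
    { finite-Q = finite-Fin nV ; finite-C = finite-⊤ ; finite-B = finite-⊤ ; c₀ = tt ; b₀ = tt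
    ; Ω = λ v → if p v then zero else suc (zero {0})
    ; δ = λ v _ _ _ → v , v ; initial = id }

  -- The reply functions of `dual` are stored as vectors to keep the choices a finite type.
  complement : Automaton → Automaton
  complement A = record
    { finite-Q = finite-Q A ; finite-C = finite-Vec (finite-B A) (size (finite-C A)) ; finite-B = finite-C A
    ; c₀ = tabulate (λ _ → b₀ A) ; b₀ = c₀ A
    ; K = suc (K A) ; Ω = λ q → suc (Ω A q)
    ; δ = λ q l f c → δ A q l c (lookup f (enc (finite-C A) c))
    ; initial = initial A }

  -- Its arena on `t` is by computation that of `A` on `f ∘ t`, so binding an agent needs no
  -- acceptance lemma.
  relabel : (Λ → Λ) → Automaton → Automaton
  relabel f A = record
    { finite-Q = finite-Q A ; finite-C = finite-C A ; finite-B = finite-B A ; c₀ = c₀ A ; b₀ = b₀ A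
    ; Ω = Ω A ; δ = λ q l → δ A q (f l) ; initial = initial A }

  -- Moves available in a fresh state: behave like one of the components at the
  -- present node, give up, or descend.
  data Move : Set where
    now₁ now₂ fail : Move
    stay enter     : V → Move

  module Compose (κ : V → Λ → Bool → Bool → Move) (A₁ A₂ : Automaton) where

    State : Set
    State = Q A₁ ⊎ Q A₂ ⊎ (Bool × V)

    pattern left q  = inj₁ q
    pattern right q = inj₂ (inj₁ q)
    pattern fresh v = inj₂ (inj₂ (true , v))
    pattern sink v  = inj₂ (inj₂ (false , v))

    perform : V → Λ → C A₁ → C A₂ → B A₁ → B A₂ → Move → State × V
    -- There are no silent moves: the component makes its first move in this very round, reading the
    -- label of the present node.
    perform v l c₁ c₂ b₁ b₂ now₁       = map₁ left (δ A₁ (initial A₁ v) l c₁ b₁)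
    perform v l c₁ c₂ b₁ b₂ now₂       = map₁ right (δ A₂ (initial A₂ v) l c₂ b₂)
    perform v l c₁ c₂ b₁ b₂ fail       = sink v , v
    perform v l c₁ c₂ b₁ b₂ (stay v′)  = fresh v′ , v′
    perform v l c₁ c₂ b₁ b₂ (enter v′) = left (initial A₁ v′) , v′

    transition : State → Λ → Bool × C A₁ × C A₂ → Bool × B A₁ × B A₂ → State × V
    transition (left q)  l (_ , c₁ , _)   (_ , b₁ , _)   = map₁ left (δ A₁ q l c₁ b₁)
    transition (right q) l (_ , _ , c₂)   (_ , _ , b₂)   = map₁ right (δ A₂ q l c₂ b₂)
    transition (fresh v) l (c , c₁ , c₂) (b , b₁ , b₂) = perform v l c₁ c₂ b₁ b₂ (κ v l c b)
    transition (sink v)  l _             _              = sink v , v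

    K₁ = K A₁
    K₂ = K A₂

    -- States outside the components get the odd priority 1, so that giving up and postponing an
    -- until forever both lose.
    priority : State → Fin (K₁ ⊔ (K₂ ⊔ 2))
    priority (left q)         = inject≤ (Ω A₁ q) (m≤m⊔n K₁ _)
    priority (right q)        = inject≤ (Ω A₂ q) (≤-trans (m≤m⊔n K₂ 2) (m≤n⊔m K₁ _))
    priority (inj₂ (inj₂ _)) = inject≤ {2} (suc zero) (≤-trans (m≤n⊔m K₂ 2) (m≤n⊔m K₁ _))

    compose : Automaton
    compose = record
      { finite-Q = finite-Q A₁ ⊎-finite finite-Q A₂ ⊎-finite (finite-Bool ×-finite finite-Fin nV)
      ; finite-C = finite-Bool ×-finite finite-C A₁ ×-finite finite-C A₂
      ; finite-B = finite-Bool ×-finite finite-B A₁ ×-finite finite-B A₂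
      ; c₀ = true , c₀ A₁ , c₀ A₂ ; b₀ = true , b₀ A₁ , b₀ A₂
      ; Ω = priority ; δ = transition ; initial = fresh }

  or-move : V → Λ → Bool → Bool → Move
  or-move v l c b = if c then now₁ else now₂

  module Moves (successor : V → Λ → Maybe V) where

    next-move′ : Maybe V → Move
    next-move′ nothing   = fail
    next-move′ (just v′) = enter v′

    next-move : V → Λ → Bool → Bool → Move
    next-move v l _ _ = next-move′ (successor v l)

    -- The unfolding of `φ U′ ψ` into `ψ`, or `φ` together with the until at the next node: the
    -- player chooses whether to stop, and if not, the opponent chooses which conjunct is checked.
    -- An undefined successor fails in all cases, since outcomes need all agents bound.
    until-move′ : Maybe V → Bool → Bool → Move
    until-move′ nothing   _     _     = fail
    until-move′ (just v′) true  _     = now₂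
    until-move′ (just v′) false true  = now₁
    until-move′ (just v′) false false = stay v′

    until-move : V → Λ → Bool → Bool → Move
    until-move v l = until-move′ (successor v l)

  -- The automaton guesses, at each node, the action to project away and a
  -- positional strategy of A there, and checks the traces of A with the
  -- deterministic automaton.  Directions are read up to the choice r of
  -- representatives, so that runs only meet representative addresses.
  module Project {Act : Set} (finite-Act : Finite Act) (act₀ : Act) (update : Act → Λ → Λ)
                 (r : V → V) (A : Automaton) where
    open Determinisation (finite-Q A) (K A) public

    Local : Set
    Local = Vec (C A) (size (finite-Q A))

    Arrow : Λ → Local → V → Q A × Fin (K A) × Q A → Set
    Arrow l f d (q , k , q′) = k ≡ Ω A q × ∃[ b ]
      proj₁ (δ A q l (lookup f (enc (finite-Q A) q)) b) ≡ q′ ×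
      r (proj₂ (δ A q l (lookup f (enc (finite-Q A) q)) b)) ≡ d

    arrow? : ∀ l f d x → Dec (Arrow l f d x)
    arrow? l f d (q , k , q′) = k Fin.≟ Ω A q ×-dec exists? (finite-B A) λ b →
      _≟_ (finite-Q A) _ q′ ×-dec _ Fin.≟ d

    letter : Λ → Local → V → Table
    letter l f d = ⟪_⟫ finite-Arrow (arrow? l f d)

    Memory : Set
    Memory = Slots capacity × Fin (priorities capacity)

    advance : Q A → Memory → Λ → Act × Local → V → Memory
    advance q₀ (us , _) l (x , f) d = step capacity (singleton q₀) us (letter (update x l) f d)

    memory₀ : Memory
    memory₀ = empty capacity , zero

    project : Automaton
    project = record
      { finite-Q = finite-Q A ×-finite finite-Slots capacity ×-finite finite-Fin (priorities capacity)
      ; finite-C = finite-Act ×-finite finite-Vec (finite-C A) (size (finite-Q A))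
      ; finite-B = finite-Fin nV
      ; c₀ = act₀ , tabulate (λ _ → c₀ A)
      ; b₀ = v₀
      ; Ω = λ (_ , _ , k) → k
      ; δ = λ (q₀ , m) l c d → (q₀ , advance q₀ m l c d) , d
      ; initial = λ v → initial A v , memory₀ }

-- Acceptance for complements, disjunctions and temporal operators

module Acceptance (em : ∀ {P : Set} → Dec P) (Λ : Set) {nV : ℕ} (v₀ : Fin nV) where
  open Automata Λ v₀
  open Automaton
  open Logic em

  determined : ∀ A t x → Win (arena A t) x ⊎ Win (dual (arena A t)) x
  determined A t = Determinacy.determined em (code A) (code-injective A) (arena A t)
    λ (q , _) → Fin.toℕ<n (Ω A q)

  determined-dual : ∀ A t x → Win (dual (arena A t)) x ⊎ Win (dual (dual (arena A t))) x
  determined-dual A t = Determinacy.determined em (code A) (code-injective A) (dual (arena A t))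
    λ (q , _) → s≤s (Fin.toℕ<n (Ω A q))

  module _ (A : Automaton) (t : Tree) where

    accepts-step : ∀ {q w} → Accepts A t q w →
      ∃[ c ] ∀ b → Win (arena A t) (Game.next (arena A t) (q , w) c b)
    accepts-step {q} {w} (s , wins) = s (q , w) , λ b → s , wins-step (arena A t) s wins b

    -- The successors may be won by different strategies. Determinacy spares gluing them: an
    -- opponent strategy winning here would also win at one of these successors.
    accepts-unstep : ∀ {q w} → ∃[ c ] (∀ b → Win (arena A t) (Game.next (arena A t) (q , w) c b)) →
      Accepts A t q w
    accepts-unstep {q} {w} (c , win) with determined A t (q , w)
    ... | inj₁ acc      = acc
    ... | inj₂ (τ , lose) =
      ⊥-elim (win-exclusive (arena A t) (win (τ (q , w) c)) (τ , wins-step (dual (arena A t)) τ lose c))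

    complement-correct : ∀ {v w} → Recognises (complement A) t v w ⇔ (¬ Recognises A t v w)
    complement-correct {v} {w} = mk⇔
      (λ acc → λ acc′ → win-exclusive (arena A t) acc′
        (win-simulation (arena (complement A) t) (dual (arena A t)) _≡_
          (λ { refl → refl }) (λ { refl f → (λ c → lookup f (enc (finite-C A) c)) , λ c → c , refl })
          refl (determined-dual A t _) acc))
      (λ ¬acc → from-dual ¬acc (determined A t _))
      where
      encode : (C A → B A) → Vec (B A) (size (finite-C A))
      encode f = tabulate (λ i → f (dec (finite-C A) i))
      encode-correct : ∀ f c → f c ≡ lookup (encode f) (enc (finite-C A) c)
      encode-correct f c = sym (trans (lookup∘tabulate _ (enc (finite-C A) c)) (cong f (dec-enc (finite-C A) c)))
      from-dual : ¬ Recognises A t v w → Win (arena A t) _ ⊎ Win (dual (arena A t)) _ →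
                  Recognises (complement A) t v w
      from-dual ¬acc (inj₁ acc)  = ⊥-elim (¬acc acc)
      from-dual ¬acc (inj₂ lose) =
        win-simulation (dual (arena A t)) (arena (complement A) t) _≡_ (λ { refl → refl })
          (λ { {x} refl f → encode f , λ c → c , cong (Game.next (arena A t) x c) (encode-correct f c) })
          refl (determined (complement A) t _) lose

  atomic-correct : ∀ p t {v w} → Recognises (atomic p) t v w ⇔ T (p v)
  atomic-correct p t {v} {w} = by-value (p v) refl
    where
    G = arena (atomic p) t
    stuck : ∀ {s π} → π 0 ≡ (v , w) → Play G s π → ∀ n → proj₁ (π n) ≡ v
    stuck eq play zero    = cong proj₁ eq
    stuck {s} eq play (suc n) = let _ , e = play n in trans (cong proj₁ e) (stuck {s} eq play n)
    priority : ∀ {b v} → p v ≡ b → toℕ (Ω (atomic p) v) ≡ toℕ {2} (if b then zero else suc zero)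
    priority refl = refl
    play₀ : ℕ → V × List V
    play₀ zero    = v , w
    play₀ (suc n) = let _ , w′ = play₀ n in v , v ∷ w′
    by-value : ∀ b → p v ≡ b → Recognises (atomic p) t v w ⇔ T (p v)
    by-value true eq = mk⇔ (λ _ → subst T (sym eq) tt) λ _ → (λ _ → tt) , λ π start play →
      parity-const λ n → trans (cong (toℕ ∘ Ω (atomic p)) (stuck {λ _ → tt} start play n)) (priority eq)
    by-value false eq = mk⇔
      (λ (s , wins) → ⊥-elim (parity-exclusive
        (wins play₀ refl λ { zero → tt , refl ; (suc n) → tt , refl })
        (parity-const λ { zero → priority eq ; (suc n) → priority eq })))
      (⊥-elim ∘ subst T eq)

  module Composition (κ : V → Λ → Bool → Bool → Move) (A₁ A₂ : Automaton) (t : Tree) where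
    open Compose κ A₁ A₂

    G = arena compose t

    priority-left : ∀ q → toℕ (Ω A₁ q) ≡ toℕ (priority (left q))
    priority-left q = sym (Fin.toℕ-inject≤ (Ω A₁ q) _)

    priority-right : ∀ q → toℕ (Ω A₂ q) ≡ toℕ (priority (right q))
    priority-right q = sym (Fin.toℕ-inject≤ (Ω A₂ q) _)

    priority-fresh : ∀ x → toℕ (priority (inj₂ (inj₂ x))) ≡ 1
    priority-fresh x = Fin.toℕ-inject≤ {2} (suc zero) _

    left-correct : ∀ {q w} → Accepts compose t (left q) w ⇔ Accepts A₁ t q w
    left-correct = mk⇔
      (win-simulation G (arena A₁ t) (λ (p , w) (q , w′) → p ≡ left q × w ≡ w′)
        (λ { (refl , refl) → sym (priority-left _) })
        (λ { (refl , refl) (_ , c , _) → c , λ b → (true , b , b₀ A₂) , refl , refl })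
        (refl , refl) (determined A₁ t _))
      (win-simulation (arena A₁ t) G (λ (q , w′) (p , w) → p ≡ left q × w ≡ w′)
        (λ { (refl , refl) → priority-left _ })
        (λ { (refl , refl) c → (true , c , c₀ A₂) , λ (_ , b , _) → b , refl , refl })
        (refl , refl) (determined compose t _))

    right-correct : ∀ {q w} → Accepts compose t (right q) w ⇔ Accepts A₂ t q w
    right-correct = mk⇔
      (win-simulation G (arena A₂ t) (λ (p , w) (q , w′) → p ≡ right q × w ≡ w′)
        (λ { (refl , refl) → sym (priority-right _) })
        (λ { (refl , refl) (_ , _ , c) → c , λ b → (true , b₀ A₁ , b) , refl , refl })
        (refl , refl) (determined A₂ t _))
      (win-simulation (arena A₂ t) G (λ (q , w′) (p , w) → p ≡ right q × w ≡ w′)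
        (λ { (refl , refl) → priority-right _ })
        (λ { (refl , refl) c → (true , c₀ A₁ , c) , λ (_ , _ , b) → b , refl , refl })
        (refl , refl) (determined compose t _))

    sink-rejects : ∀ {v w} → ¬ Accepts compose t (sink v) w
    sink-rejects {v} {w} (s , wins) = parity-exclusive
      (wins π refl λ { zero → b₀ compose , refl ; (suc n) → b₀ compose , refl })
      (parity-const λ { zero → priority-fresh (false , v) ; (suc n) → priority-fresh (false , v) })
      where
      π : ℕ → State × List V
      π zero    = sink v , w
      π (suc n) = let _ , w′ = π n in sink v , v ∷ w′

    ⟦_⟧ : Move → V → List V → Set
    ⟦ now₁ ⟧     v w = Recognises A₁ t v w
    ⟦ now₂ ⟧     v w = Recognises A₂ t v w
    ⟦ fail ⟧     v w = ⊥
    ⟦ stay v′ ⟧  v w = Recognises compose t v′ (v′ ∷ w)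
    ⟦ enter v′ ⟧ v w = Recognises A₁ t v′ (v′ ∷ w)

    perform-sound : ∀ {v w} c₁ c₂ m →
      (∀ b₁ b₂ → let q , v′ = perform v (t w) c₁ c₂ b₁ b₂ m in Accepts compose t q (v′ ∷ w)) → ⟦ m ⟧ v w
    perform-sound _ _ now₁ acc = accepts-unstep A₁ t (_ , λ b₁ → Equivalence.to left-correct (acc b₁ (b₀ A₂)))
    perform-sound _ _ now₂ acc = accepts-unstep A₂ t (_ , λ b₂ → Equivalence.to right-correct (acc (b₀ A₁) b₂))
    perform-sound _ _ fail acc       = sink-rejects (acc (b₀ A₁) (b₀ A₂))
    perform-sound _ _ (stay v′) acc  = acc (b₀ A₁) (b₀ A₂)
    perform-sound _ _ (enter v′) acc = Equivalence.to left-correct (acc (b₀ A₁) (b₀ A₂))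

    choice : ∀ A v w → ∃[ c ] (Recognises A t v w → ∀ b → Win (arena A t) (Game.next (arena A t) (initial A v , w) c b))
    choice A v w with em {Recognises A t v w}
    ... | yes acc = let c , acc′ = accepts-step A t acc in c , λ _ → acc′
    ... | no ¬acc = c₀ A , λ acc → ⊥-elim (¬acc acc)

    fresh-correct : ∀ {v w} → Recognises compose t v w ⇔ (∃[ c ] ∀ b → ⟦ κ v (t w) c b ⟧ v w)
    fresh-correct {v} {w} = mk⇔ to from
      where
      to : Recognises compose t v w → ∃[ c ] (∀ b → ⟦ κ v (t w) c b ⟧ v w)
      to acc = let (c , c₁ , c₂) , acc′ = accepts-step compose t acc in
        c , λ b → perform-sound c₁ c₂ (κ v (t w) c b) λ b₁ b₂ → acc′ (b , b₁ , b₂)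
      from : ∃[ c ] (∀ b → ⟦ κ v (t w) c b ⟧ v w) → Recognises compose t v w
      from (c , ok) = accepts-unstep compose t
        ((c , c₁ , c₂) , λ (b , b₁ , b₂) → complete b₁ b₂ (κ v (t w) c b) (ok b))
        where
        c₁ = proj₁ (choice A₁ v w)
        c₂ = proj₁ (choice A₂ v w)
        complete : ∀ b₁ b₂ m → ⟦ m ⟧ v w →
                   let q , v′ = perform v (t w) c₁ c₂ b₁ b₂ m in Accepts compose t q (v′ ∷ w)
        complete b₁ b₂ now₁ acc       = Equivalence.from left-correct (proj₂ (choice A₁ v w) acc b₁)
        complete b₁ b₂ now₂ acc       = Equivalence.from right-correct (proj₂ (choice A₂ v w) acc b₂)
        complete b₁ b₂ (stay v′) acc  = acc
        complete b₁ b₂ (enter v′) acc = Equivalence.from left-correct acc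

  or-correct : ∀ A₁ A₂ t {v w} → Recognises (Compose.compose or-move A₁ A₂) t v w ⇔
               (Recognises A₁ t v w ⊎ Recognises A₂ t v w)
  or-correct A₁ A₂ t = mk⇔
    (λ acc → let c , ok = Equivalence.to fresh-correct acc in by-choice c (ok true))
    λ { (inj₁ acc) → Equivalence.from fresh-correct (true , λ _ → acc)
      ; (inj₂ acc) → Equivalence.from fresh-correct (false , λ _ → acc) }
    where
    open Composition or-move A₁ A₂ t
    by-choice : ∀ {v w} c → ⟦ if c then now₁ else now₂ ⟧ v w → Recognises A₁ t v w ⊎ Recognises A₂ t v w
    by-choice true  = inj₁
    by-choice false = inj₂

  module Temporal (successor : V → Λ → Maybe V) where
    open Moves successor

    next-correct : ∀ A t {v w} → Recognises (Compose.compose next-move A A) t v w ⇔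
                   (∃[ v′ ] successor v (t w) ≡ just v′ × Recognises A t v′ (v′ ∷ w))
    next-correct A t {v} {w} = mk⇔
      (λ acc → to (successor v (t w)) refl (Equivalence.to fresh-correct acc .proj₂ true))
      λ (v′ , eq , acc) → Equivalence.from fresh-correct
        (true , λ _ → subst (λ m → ⟦ next-move′ m ⟧ v w) (sym eq) acc)
      where
      open Composition next-move A A t
      to : ∀ m → successor v (t w) ≡ m → ⟦ next-move′ m ⟧ v w →
           ∃[ v′ ] successor v (t w) ≡ just v′ × Recognises A t v′ (v′ ∷ w)
      to (just v′) eq acc = v′ , eq , acc

    -- `stop` asks for a successor as well, matching the semantics, where an until holds only under
    -- complete assignments.
    data Until (t : Tree) (P R : V → List V → Set) (v : V) (w : List V) : Set where
      stop : ∀ {v′} → successor v (t w) ≡ just v′ → R v w → Until t P R v w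
      step : ∀ {v′} → successor v (t w) ≡ just v′ → P v w → Until t P R v′ (v′ ∷ w) → Until t P R v w

    module _ (A₁ A₂ : Automaton) (t : Tree) where
      open Composition until-move A₁ A₂ t
      open Compose until-move A₁ A₂

      Held : V → List V → Set
      Held = Until t (Recognises A₁ t) (Recognises A₂ t)

      until-complete : ∀ {v w} → Held v w → Recognises compose t v w
      until-complete {v} {w} (stop eq acc) = Equivalence.from fresh-correct
        (true , λ b → subst (λ m → ⟦ until-move′ m true b ⟧ v w) (sym eq) acc)
      until-complete {v} {w} (step {v′} eq acc rest) = Equivalence.from fresh-correct
        (false , λ b → subst (λ m → ⟦ until-move′ m false b ⟧ v w) (sym eq) (both b))
        where
        both : ∀ b → ⟦ until-move′ (just v′) false b ⟧ v w
        both true  = acc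
        both false = until-complete rest

      -- A winning strategy that never stops would follow fresh states forever,
      -- and these have an odd priority.
      until-sound : ∀ {v w} → Recognises compose t v w → Held v w
      until-sound {v} {w} (s , wins) = dne λ ¬holds →
        parity-exclusive
          (wins (position ∘ run ¬holds) refl (λ n → proj₂ (forward (run ¬holds n))))
          (parity-const λ n → priority-fresh (true , node (run ¬holds n)))
        where
        record Pending : Set where
          pattern
          constructor pending
          field
            {node}   : V
            {addr}   : List V
            winning  : Wins G s (fresh node , addr)
            not-held : ¬ Held node addr
        open Pending
        position : Pending → State × List V
        position p = fresh (node p) , addr p
        forward : ∀ p → Σ[ p′ ∈ Pending ] ∃[ b ] position p′ ≡ Game.next G (position p) (s (position p)) b
        forward (pending {v} {w} win ¬held) = by-choice (s (fresh v , w)) refl (successor v (t w)) refl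
          where
          Next : Set
          Next = Σ[ p′ ∈ Pending ] ∃[ b ] position p′ ≡ Game.next G (fresh v , w) (s (fresh v , w)) b
          by-choice : ∀ x → s (fresh v , w) ≡ x → ∀ m → successor v (t w) ≡ m → Next
          by-choice (c , c₁ , c₂) eq nothing eqₘ =
            ⊥-elim (perform-sound c₁ c₂ fail λ b₁ b₂ → s ,
              subst₂ (λ x m → Wins G s (let q , v′ = perform v (t w) (proj₁ (proj₂ x)) (proj₂ (proj₂ x)) b₁ b₂
                                                  (until-move′ m (proj₁ x) true) in q , v′ ∷ w))
                eq eqₘ (wins-step G s win (true , b₁ , b₂)))
          by-choice (true , c₁ , c₂) eq (just v′) eqₘ =
            ⊥-elim (¬held (stop eqₘ (perform-sound c₁ c₂ now₂ λ b₁ b₂ → s ,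
              subst₂ (λ x m → Wins G s (let q , v′ = perform v (t w) (proj₁ (proj₂ x)) (proj₂ (proj₂ x)) b₁ b₂
                                                  (until-move′ m (proj₁ x) true) in q , v′ ∷ w))
                eq eqₘ (wins-step G s win (true , b₁ , b₂)))))
          by-choice (false , c₁ , c₂) eq (just v′) eqₘ =
            pending win′ (λ held → ¬held (step eqₘ acc held)) , (false , b₀ A₁ , b₀ A₂) , sym moves
            where
            acc : Recognises A₁ t v w
            acc = perform-sound c₁ c₂ now₁ λ b₁ b₂ → s ,
              subst₂ (λ x m → Wins G s (let q , v′ = perform v (t w) (proj₁ (proj₂ x)) (proj₂ (proj₂ x)) b₁ b₂
                                                  (until-move′ m (proj₁ x) true) in q , v′ ∷ w))
                eq eqₘ (wins-step G s win (true , b₁ , b₂))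
            moves : Game.next G (fresh v , w) (s (fresh v , w)) (false , b₀ A₁ , b₀ A₂) ≡ (fresh v′ , v′ ∷ w)
            moves = trans (cong (λ x → Game.next G (fresh v , w) x (false , b₀ A₁ , b₀ A₂)) eq)
                          (cong (λ m → let q , v″ = perform v (t w) c₁ c₂ (b₀ A₁) (b₀ A₂)
                                                      (until-move′ m false false) in q , v″ ∷ w) eqₘ)
            win′ : Wins G s (fresh v′ , v′ ∷ w)
            win′ = subst (Wins G s) moves (wins-step G s win (false , b₀ A₁ , b₀ A₂))
        run : ¬ Held v w → ℕ → Pending
        run ¬holds zero    = pending wins ¬holds
        run ¬holds (suc n) = proj₁ (forward (run ¬holds n))

      until-correct : ∀ {v w} → Recognises compose t v w ⇔ Held v w
      until-correct = mk⇔ until-sound until-complete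

-- Correctness of projection

module Projection (em : ∀ {P : Set} → Dec P) (Λ : Set) {nV : ℕ} (v₀ : Fin nV)
                  {Act : Set} (finite-Act : Finite Act) (act₀ : Act) (update : Act → Λ → Λ)
                  (_~_ : Fin nV → Fin nV → Set) (~-refl : ∀ (v : Fin nV) → v ~ v)
                  (r : Fin nV → Fin nV) (~-r : ∀ (v : Fin nV) → v ~ r v)
                  (r-cong : ∀ {u v : Fin nV} → u ~ v → r u ≡ r v)
                  (A : Automata.Automaton Λ v₀) where
  open Automata Λ v₀
  open Automaton
  open Acceptance em Λ v₀
  open Logic em
  open Project finite-Act act₀ update r A

  _≈_ : List V → List V → Set
  _≈_ = Pointwise _~_

  ≈-refl : ∀ w → w ≈ w
  ≈-refl []      = []
  ≈-refl (v ∷ w) = ~-refl v ∷ ≈-refl w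

  ≈-map-r : ∀ w → w ≈ map r w
  ≈-map-r []      = []
  ≈-map-r (v ∷ w) = ~-r v ∷ ≈-map-r w

  Uniformₜ : {X : Set} → (List V → X) → Set
  Uniformₜ f = ∀ {w w′} → w ≈ w′ → f w ≡ f w′

  module _ (t : Tree) (t-uniform : Uniformₜ t) where

    labelled : (List V → Act) → Tree
    labelled σ w = update (σ w) (t w)

    module Complete {σ : List V → Act} (σ-uniform : Uniformₜ σ) {v : V} {w : List V} where

      q₀ : Q A
      q₀ = initial A v

      -- A read along representative addresses only.
      G : Game (Q A × List V)
      G = record
        { C = C A ; B = B A ; c₀ = c₀ A ; b₀ = b₀ A
        ; next = λ (q , y) c b → let q′ , v = δ A q (labelled σ y) c b in q′ , r v ∷ y
        ; Ω = λ (q , _) → toℕ (Ω A q) }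

      -- Uniform labels are equal on equivalent addresses, so replacing each direction by its
      -- representative preserves the win.
      representative : Recognises A (labelled σ) v w → Win G (q₀ , w)
      representative = win-simulation (arena A (labelled σ)) G
        (λ (q , y) (q′ , y′) → q ≡ q′ × y ≈ y′)
        (λ { (refl , _) → refl })
        (λ { {q , _} (refl , y≈y′) c → c , λ b → b ,
             descend y≈y′ (cong (λ l → δ A q l c b) (cong₂ update (σ-uniform y≈y′) (t-uniform y≈y′))) })
        (refl , ≈-refl w)
        (Determinacy.determined em (code A) (code-injective A) G (λ (q , _) → Fin.toℕ<n (Ω A q)) _)
        where
        descend : ∀ {y y′ x x′} → y ≈ y′ → x ≡ x′ → proj₁ x ≡ proj₁ x′ × (proj₂ x ∷ y) ≈ (r (proj₂ x′) ∷ y′)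
        descend y≈y′ refl = refl , ~-r _ ∷ y≈y′

      -- The strategy on representatives is guessed as one local table per address. A trace checked
      -- by the deterministic automaton is then a play of this strategy in `G`, hence not odd.
      complete : Recognises A (labelled σ) v w → Recognises project t v w
      complete acc = strategy , wins
        where
        s = representative acc .proj₁
        local : List V → Local
        local y = tabulate (λ i → s (dec (finite-Q A) i , y))
        local-lookup : ∀ q y → lookup (local y) (enc (finite-Q A) q) ≡ s (q , y)
        local-lookup q y = trans (lookup∘tabulate _ (enc (finite-Q A) q))
                                 (cong (λ q → s (q , y)) (dec-enc (finite-Q A) q))
        strategy : (Q A × Memory) × List V → Act × Local
        strategy (_ , y) = σ y , local y
        wins : Wins (arena project t) strategy (initial project v , w)
        wins π start play =
          -- The priority of a step is stored in the memory it leads to, hence the shift by one.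
          parity-undrop 1 (parity-cong (λ n → cong (toℕ ∘ proj₂) (sym (memory-step n)))
            (no-odd-trace⇒even slots _ (cong (proj₁ ∘ proj₂ ∘ proj₁) start)
              (λ n → cong proj₁ (memory-step n)) (λ n → refl) no-odd-trace))
          where
          addr : ℕ → List V
          addr n = proj₂ (π n)
          dir : ℕ → V
          dir n = proj₁ (play n)
          memory : ℕ → Memory
          memory n = proj₂ (proj₁ (π n))
          slots : ℕ → Slots capacity
          slots n = proj₁ (memory n)
          word : ℕ → Table
          word n = letter (labelled σ (addr n)) (local (addr n)) (dir n)
          open Correct (finite-Q A) (K A) word em q₀
          origin : ∀ n → proj₁ (proj₁ (π n)) ≡ q₀
          origin zero    = cong (proj₁ ∘ proj₁) start
          origin (suc n) = trans (cong (proj₁ ∘ proj₁) (proj₂ (play n))) (origin n)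
          memory-step : ∀ n → memory (suc n) ≡ step capacity (singleton q₀) (slots n) (word n)
          memory-step n = trans (cong (proj₂ ∘ proj₁) (proj₂ (play n)))
            (cong (λ q → step capacity (singleton q) (slots n) (word n)) (origin n))
          no-odd-trace : ¬ OddTrace
          no-odd-trace (ρ , κ , (ρ₀ , edges) , odd) = parity-exclusive
            (representative acc .proj₂ (λ n → ρ n , addr n) (cong₂ _,_ ρ₀ (cong proj₂ start)) follow)
            (parity-cong (λ n → cong toℕ (proj₁ (arrow n))) odd)
            where
            arrow : ∀ n → Arrow (labelled σ (addr n)) (local (addr n)) (dir n) (ρ n , κ n , ρ (suc n))
            arrow n = ∈⟪⟫⁻ finite-Arrow (arrow? (labelled σ (addr n)) (local (addr n)) (dir n)) (edges n)
            follow : Play G s (λ n → ρ n , addr n)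
            follow n with arrow n
            ... | _ , b , to , toward rewrite local-lookup (ρ n) (addr n) =
              b , cong₂ _,_ (sym to) (trans (cong proj₂ (proj₂ (play n))) (cong (_∷ addr n) (sym toward)))

    module Sound {v : V} {w : List V} (ŝ : (Q A × Memory) × List V → Act × Local)
                 (ŝ-wins : Wins (arena project t) ŝ (initial project v , w)) where

      q₀ : Q A
      q₀ = initial A v

      -- The memory is determined by the directions read since `w`, and hence so is the choice: one
      -- action and one local strategy per address, whatever state `A` is in.
      memory : List V → Memory
      choice : List V → Act × Local
      memory []      = memory₀
      memory (d ∷ u) = advance q₀ (memory u) (t (u ++ w)) (choice u) d
      choice u       = ŝ ((q₀ , memory u) , u ++ w)

      -- Cutting by length rather than by matching `w` gives a function on all addresses that cuts
      -- equivalent ones at the same place.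
      below : List V → List V
      below y = take (length y ∸ length w) y

      choice-at : List V → Act × Local
      choice-at y = choice (map r (below y))

      map-r-take : ∀ n {y y′} → y ≈ y′ → map r (take n y) ≡ map r (take n y′)
      map-r-take zero    _          = refl
      map-r-take (suc n) []         = refl
      map-r-take (suc n) (eq ∷ eqs) = cong₂ _∷_ (r-cong eq) (map-r-take n eqs)

      choice-at-uniform : Uniformₜ choice-at
      choice-at-uniform {y} {y′} y≈y′ rewrite Pointwise-length y≈y′ =
        cong choice (map-r-take (length y′ ∸ length w) y≈y′)

      take-prefix : ∀ (u : List V) → take (length u) (u ++ w) ≡ u
      take-prefix []      = refl
      take-prefix (d ∷ u) = cong (d ∷_) (take-prefix u)

      below-++ : ∀ u → below (u ++ w) ≡ u
      below-++ u rewrite length-++ u {w} | m+n∸n≡m (length u) (length w) = take-prefix u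

      σ : List V → Act
      σ = proj₁ ∘ choice-at

      s : Q A × List V → C A
      s (q , y) = lookup (proj₂ (choice-at y)) (enc (finite-Q A) q)

      s-wins : Wins (arena A (labelled σ)) s (q₀ , w)
      s-wins π start play with parity-total {toℕ ∘ Ω A ∘ proj₁ ∘ π} (λ n → Fin.toℕ<n (Ω A (proj₁ (π n))))
      ... | inj₁ par = par
      -- An odd play of `A` would be an odd trace of the word along its representative path, where
      -- `ŝ` ensures that there is none.
      ... | inj₂ odd =
        ⊥-elim (even⇒no-odd-trace (proj₁ ∘ memory ∘ rep) (proj₂ ∘ memory ∘ rep ∘ suc) refl (λ _ → refl) (λ _ → refl)
          (parity-drop 1 (ŝ-wins (λ n → (q₀ , memory (rep n)) , rep n ++ w) refl λ n → r (dir n) , refl))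
          (state , Ω A ∘ state , (cong proj₁ start , edge) , odd))
        where
        state : ℕ → Q A
        state n = proj₁ (π n)
        reply : ℕ → B A
        reply n = proj₁ (play n)
        dir : ℕ → V
        dir n = proj₂ (δ A (state n) (labelled σ (proj₂ (π n))) (s (π n)) (reply n))
        path rep : ℕ → List V
        path zero    = []
        path (suc n) = dir n ∷ path n
        rep n        = map r (path n)
        addr : ∀ n → proj₂ (π n) ≡ path n ++ w
        addr zero    = cong proj₂ start
        addr (suc n) = trans (cong proj₂ (proj₂ (play n))) (cong (dir n ∷_) (addr n))
        label : ℕ → Λ
        label n = update (proj₁ (choice (rep n))) (t (rep n ++ w))
        word : ℕ → Table
        word n = letter (label n) (proj₂ (choice (rep n))) (r (dir n))
        open Correct (finite-Q A) (K A) word em q₀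
        choice≡ : ∀ n → choice-at (proj₂ (π n)) ≡ choice (rep n)
        choice≡ n = cong (choice ∘ map r) (trans (cong below (addr n)) (below-++ (path n)))
        tree≡ : ∀ n → t (proj₂ (π n)) ≡ t (rep n ++ w)
        tree≡ n = trans (cong t (addr n)) (t-uniform (++⁺ (≈-map-r (path n)) (≈-refl w)))
        moves : ∀ n → δ A (state n) (label n) (lookup (proj₂ (choice (rep n))) (enc (finite-Q A) (state n))) (reply n)
                    ≡ δ A (state n) (labelled σ (proj₂ (π n))) (s (π n)) (reply n)
        moves n rewrite choice≡ n | tree≡ n = refl
        edge : ∀ n → state n -[ word n , Ω A (state n) ]→ state (suc n)
        edge n = ∈⟪⟫⁺ finite-Arrow (arrow? (label n) (proj₂ (choice (rep n))) (r (dir n)))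
          (refl , reply n , trans (cong proj₁ (moves n)) (sym (cong proj₁ (proj₂ (play n)))) ,
           cong (r ∘ proj₂) (moves n))

    project-correct : ∀ {v w} → Recognises project t v w ⇔
                      (∃[ σ ] Uniformₜ σ × Recognises A (labelled σ) v w)
    project-correct = mk⇔
      (λ (ŝ , wins) → let open Sound ŝ wins in
        σ , (λ eq → cong proj₁ (choice-at-uniform eq)) , s , s-wins)
      (λ (σ , uniform , acc) → Complete.complete uniform acc)

-- Deciding acceptance on a constant tree

minimiser : ∀ d (a : ℕ → ℕ) → ∃[ m ] m ≤ d × (∀ n → n ≤ d → a m ≤ a n)
minimiser zero    a = 0 , z≤n , λ { _ z≤n → ≤-refl }
minimiser (suc d) a with minimiser d a
... | m , m≤d , min with ≤-total (a m) (a (suc d))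
...   | inj₁ le = m , ≤-trans m≤d (n≤1+n d) , λ n n≤ → by-cases n (m≤n⇒m<n∨m≡n n≤)
  where
  by-cases : ∀ n → n < suc d ⊎ n ≡ suc d → a m ≤ a n
  by-cases n (inj₁ lt)   = min n (s≤s⁻¹ lt)
  by-cases n (inj₂ refl) = le
...   | inj₂ ge = suc d , ≤-refl , λ n n≤ → by-cases n (m≤n⇒m<n∨m≡n n≤)
  where
  by-cases : ∀ n → n < suc d ⊎ n ≡ suc d → a (suc d) ≤ a n
  by-cases n (inj₁ lt)   = ≤-trans ge (min n (s≤s⁻¹ lt))
  by-cases n (inj₂ refl) = ≤-refl

module Orbit {X : Set} (F : Finite X) (g : X → X) (x₀ : X) (priority : X → ℕ) where

  orbit : ℕ → X
  orbit zero    = x₀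
  orbit (suc n) = g (orbit n)

  repetition : ∃[ i ] ∃[ d ] orbit (suc d + i) ≡ orbit i
  repetition with Fin.pigeonhole (n<1+n (size F)) (enc F ∘ orbit ∘ toℕ)
  ... | i , j , i<j , eq = toℕ i , toℕ j ∸ suc (toℕ i) ,
    trans (cong orbit (trans (sym (+-suc _ (toℕ i))) (m∸n+n≡m i<j))) (sym (enc-injective F eq))

  i d : ℕ
  i = proj₁ repetition
  d = proj₁ (proj₂ repetition)

  orbit-shift : ∀ {m n} → orbit m ≡ orbit n → ∀ l → orbit (l + m) ≡ orbit (l + n)
  orbit-shift eq zero    = eq
  orbit-shift eq (suc l) = cong g (orbit-shift eq l)

  periodic : ∀ k l → orbit (l + k * suc d + i) ≡ orbit (l + i)
  periodic zero    l = cong (λ m → orbit (m + i)) (+-identityʳ l)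
  periodic (suc k) l = begin
    orbit (l + (suc d + k * suc d) + i) ≡⟨ cong orbit (+-assoc l (suc d + k * suc d) i) ⟩
    orbit (l + (suc d + k * suc d + i)) ≡⟨ cong (λ m → orbit (l + (m + i))) (+-comm (suc d) (k * suc d)) ⟩
    orbit (l + (k * suc d + suc d + i)) ≡⟨ cong (λ m → orbit (l + m)) (+-assoc (k * suc d) (suc d) i) ⟩
    orbit (l + (k * suc d + (suc d + i))) ≡⟨ cong orbit (+-assoc l (k * suc d) (suc d + i)) ⟨
    orbit (l + k * suc d + (suc d + i)) ≡⟨ orbit-shift (proj₂ (proj₂ repetition)) (l + k * suc d) ⟩
    orbit (l + k * suc d + i)           ≡⟨ periodic k l ⟩
    orbit (l + i)                       ∎
    where open ≡-Reasoning

  -- An orbit in a finite set is ultimately periodic, and the least priority within one period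
  -- recurs and bounds the later ones. The argument is constructive, as the decision procedure
  -- needs.
  orbit-parity : ∃[ b ] Parity b (priority ∘ orbit)
  orbit-parity with minimiser d (λ m → priority (orbit (m + i)))
  ... | m , _ , min = _ , priority (orbit (m + i)) , refl , (i , lower) , recurs
    where
    lower : ∀ n → i ≤ n → priority (orbit (m + i)) ≤ priority (orbit n)
    lower n i≤n = ≤-trans (min (x % suc d) (s≤s⁻¹ (m%n<n x (suc d)))) (≤-reflexive (cong priority (begin
      orbit (x % suc d + i)                     ≡⟨ periodic (x / suc d) (x % suc d) ⟨
      orbit (x % suc d + x / suc d * suc d + i) ≡⟨ cong (λ m → orbit (m + i)) (m≡m%n+[m/n]*n x (suc d)) ⟨
      orbit (x + i)                             ≡⟨ cong orbit (m∸n+n≡m i≤n) ⟩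
      orbit n                                   ∎)))
      where
      open ≡-Reasoning
      x = n ∸ i
    recurs : Infinitely (λ n → priority (orbit n) ≡ priority (orbit (m + i)))
    recurs N = m + N * suc d + i ,
      ≤-trans (m≤m*n N (suc d)) (≤-trans (m≤n+m (N * suc d) m) (m≤m+n _ i)) ,
      cong priority (periodic N m)

  even? : Dec (Parity true (priority ∘ orbit))
  even? with orbit-parity
  ... | true  , par = yes par
  ... | false , par = no λ par′ → parity-exclusive par′ par

-- The finite game is solved by trying all positional strategies `f`. For a fixed `f`, all traces
-- are checked by the deterministic automaton on a constant word, whose run is an orbit in a finite
-- set.
module Decision (Λ : Set) {nV : ℕ} (v₀ : Fin nV) (A : Automata.Automaton Λ v₀) (l : Λ) (v : Fin nV) where
  open Automata Λ v₀
  open Automaton A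
  -- Nothing is projected, and all directions collapse to `v₀`; only the deterministic trace
  -- automaton is reused.
  open Project finite-⊤ tt (λ _ l → l) (λ _ → v₀) A

  q₀ : Q
  q₀ = initial v

  finite-Memory : Finite Memory
  finite-Memory = finite-Slots capacity ×-finite finite-Fin (priorities capacity)

  next-memory : Local → Memory → Memory
  next-memory f m = advance q₀ m l (tt , f) v₀

  module LocalOrbit (f : Local) = Orbit finite-Memory (next-memory f) memory₀ (toℕ ∘ proj₂)

  Wins-with : Local → Set
  Wins-with f = Parity true (toℕ ∘ proj₂ ∘ LocalOrbit.orbit f)

  winning? : Dec (∃[ f ] Wins-with f)
  winning? = exists? (finite-Vec finite-C (size finite-Q)) (λ f → LocalOrbit.even? f)

  -- On a constant tree the addresses are irrelevant, so that acceptance is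
  -- decided by a game on the finitely many states.
  module _ (em : ∀ {P : Set} → Dec P) where
    open Acceptance em Λ v₀
    open Logic em

    G : Game Q
    G = record
      { C = C ; B = B ; c₀ = c₀ ; b₀ = b₀
      ; next = λ q c b → proj₁ (δ q l c b) ; Ω = toℕ ∘ Ω }

    recognises⇔win : ∀ {w} → Recognises (λ _ → l) v w ⇔ Win G q₀
    recognises⇔win = mk⇔
      (win-simulation (arena _) G (λ (q , _) q′ → q ≡ q′) (λ { refl → refl })
        (λ { refl c → c , λ b → b , refl }) refl
        (Determinacy.determined em (toℕ ∘ enc finite-Q) (enc-injective finite-Q ∘ Fin.toℕ-injective)
          G (Fin.toℕ<n ∘ Ω) q₀))
      (win-simulation G (arena _) (λ q (q′ , _) → q ≡ q′) (λ { refl → refl })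
        (λ { refl c → c , λ b → b , refl }) refl (determined A _ _))

    module _ (f : Local) where
      open LocalOrbit f
      open Correct finite-Q K (λ _ → letter l f v₀) em q₀

      orbit-correct : Wins-with f ⇔ (¬ OddTrace)
      orbit-correct = mk⇔
        (λ par → even⇒no-odd-trace (proj₁ ∘ orbit) (proj₂ ∘ orbit ∘ suc) refl (λ _ → refl) (λ _ → refl)
                   (parity-drop 1 par))
        (λ none → parity-undrop 1
          (no-odd-trace⇒even (proj₁ ∘ orbit) (proj₂ ∘ orbit ∘ suc) refl (λ _ → refl) (λ _ → refl) none))

    win⇔winning : Win G q₀ ⇔ (∃[ f ] Wins-with f)
    win⇔winning = mk⇔ to from
      where
      to : Win G q₀ → ∃[ f ] Wins-with f
      to (s , wins) = f , Equivalence.from (orbit-correct f) λ (π , κ , (π₀ , edges) , odd) →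
        let arrow = λ n → ∈⟪⟫⁻ finite-Arrow (arrow? l f v₀) (edges n) in
        parity-exclusive
          (wins π π₀ λ n → let _ , b , eq , _ = arrow n in
            b , trans (sym eq) (cong (λ c → proj₁ (δ (π n) l c b)) (f-lookup (π n))))
          (parity-cong (λ n → cong toℕ (proj₁ (arrow n))) odd)
        where
        f : Local
        f = tabulate (s ∘ dec finite-Q)
        f-lookup : ∀ q → lookup f (enc finite-Q q) ≡ s q
        f-lookup q = trans (lookup∘tabulate _ (enc finite-Q q)) (cong s (dec-enc finite-Q q))
      from : ∃[ f ] Wins-with f → Win G q₀
      from (f , par) = (λ q → lookup f (enc finite-Q q)) , wins
        where
        wins : Wins G (λ q → lookup f (enc finite-Q q)) q₀
        wins π π₀ play with parity-total {toℕ ∘ Ω ∘ π} (λ n → Fin.toℕ<n (Ω (π n)))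
        ... | inj₁ even = even
        ... | inj₂ odd  = ⊥-elim (Equivalence.to (orbit-correct f) par
          (π , Ω ∘ π , (π₀ , λ n → let b , eq = play n in
            ∈⟪⟫⁺ finite-Arrow (arrow? l f v₀) (refl , b , sym eq , refl)) , odd))

    winning-correct : ∀ {w} → Recognises (λ _ → l) v w ⇔ (∃[ f ] Wins-with f)
    winning-correct = mk⇔ (Equivalence.to win⇔winning ∘ Equivalence.to recognises⇔win)
                          (Equivalence.from recognises⇔win ∘ Equivalence.from win⇔winning)

open Equivalence using (to; from)

-- Translation of formulas

first : ∀ {n} → (Fin n → Bool) → Maybe (Fin n)
first {zero}  p = nothing
first {suc n} p = if p zero then just zero else Maybe.map suc (first (p ∘ suc))

first-cong : ∀ {n} {p p′ : Fin n → Bool} → (∀ i → p i ≡ p′ i) → first p ≡ first p′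
first-cong {zero}  eq = refl
first-cong {suc n} eq rewrite eq zero | first-cong (eq ∘ suc) = refl

first-sound : ∀ {n} (p : Fin n → Bool) {i} → first p ≡ just i → T (p i)
first-sound {suc n} p eq with p zero in p₀
first-sound {suc n} p refl | true = subst T (sym p₀) tt
... | false with first (p ∘ suc) in rest
first-sound {suc n} p refl | false | just j = first-sound (p ∘ suc) rest

first-complete : ∀ {n} (p : Fin n → Bool) {i} → T (p i) → first p ≢ nothing
first-complete {suc n} p {i} t eq with p zero in p₀
first-complete {suc n} p {zero}  t eq | false = subst T p₀ t
first-complete {suc n} p {suc i} t eq | false with first (p ∘ suc) in rest
... | nothing = first-complete (p ∘ suc) t rest

T-ext : ∀ {b b′} → (T b → T b′) → (T b′ → T b) → b ≡ b′
T-ext {true}  {true}  f g = refl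
T-ext {false} {false} f g = refl
T-ext {true}  {false} f g = ⊥-elim (f tt)
T-ext {false} {true}  f g = ⊥-elim (g tt)

all-just : ∀ {A : Set} {n} → Vec (Maybe A) n → Maybe (Vec A n)
all-just []             = just []
all-just (nothing ∷ xs) = nothing
all-just (just x ∷ xs)  = Maybe.map (x ∷_) (all-just xs)

all-just-complete : ∀ {A B : Set} {n} (f : A → B) (xs : Vec (Maybe A) n)
  (c : ∀ i → Is-just (lookup xs i)) →
  all-just (Vec.map (Maybe.map f) xs) ≡ just (tabulate (λ i → f (to-witness (c i))))
all-just-complete f []            c = refl
all-just-complete f (just x ∷ xs) c with c zero
... | just _ rewrite all-just-complete f xs (c ∘ suc) = refl
all-just-complete f (nothing ∷ xs) c with c zero
... | ()

all-just-defined : ∀ {A B : Set} {n} (f : A → B) (xs : Vec (Maybe A) n) {ys} →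
  all-just (Vec.map (Maybe.map f) xs) ≡ just ys → ∀ i → Is-just (lookup xs i)
all-just-defined f (just x ∷ xs) eq zero = just tt
all-just-defined f (just x ∷ xs) eq (suc i) with all-just (Vec.map (Maybe.map f) xs) in eq′
... | just _ = all-just-defined f xs eq′ i

module Translation {S : Signature} (G : CGSi S) where
  open Signature S
  open CGSi G
  open Syntax S
  open Plays G
  open Semantics G

  -- The actions that an assignment prescribes at a node.
  Label : Set
  Label = Vec (Maybe Action) nAg × Vec (Maybe Action) nVar

  open Automata Label vι

  successor : Position → Label → Maybe Position
  successor v (αs , _) = Maybe.map (E v) (all-just αs)

  bind : Agent → Var → Label → Label
  bind a x (αs , βs) = αs [ a ]≔ lookup βs x , βs

  assign : Var → Action → Label → Label
  assign x α (αs , βs) = αs , βs [ x ]≔ just α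

  -- `first` sees only the class of `v`, so equivalent positions share a representative; by
  -- reflexivity the default never occurs.
  representative : Obs → Position → Position
  representative o v = fromMaybe v (first (O o v))

  -- Without actions there are no strategies, so the quantifier is false; `project` needs a default
  -- action.
  quantify : ∀ {n} → (Fin n → Label → Label) → (Position → Position) → Automaton → Automaton
  quantify {zero}  update r A = atomic (λ _ → false)
  quantify {suc n} update r A = Project.project (finite-Fin (suc n)) zero update r A

  open Moves successor

  automaton : Formula → Automaton
  automaton (atom p)        = atomic (λ v → ℓ v p)
  automaton (¬′ φ)          = complement (automaton φ)
  automaton (φ ∨′ ψ)        = Compose.compose or-move (automaton φ) (automaton ψ)
  automaton (X′ φ)          = Compose.compose next-move (automaton φ) (automaton φ)
  automaton (φ U′ ψ)        = Compose.compose until-move (automaton φ) (automaton ψ)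
  automaton (∃′[ o ] x ∙ φ) = quantify (assign x) (representative o) (automaton φ)
  automaton (⟨ a , x ⟩ φ)   = relabel (bind a x) (automaton φ)

  undefined : Label
  undefined = replicate nAg nothing , replicate nVar nothing

  decision : ∀ φ → Dec _
  decision φ = Decision.winning? Label vι (automaton φ) undefined vι

  ~-refl : ∀ o v → T (O o v v)
  ~-refl o v = IsEquivalence.refl (O-equivalence o)

  ~-representative : ∀ o v → T (O o v (representative o v))
  ~-representative o v with first (O o v) in eq
  ... | just u  = first-sound (O o v) eq
  ... | nothing = ~-refl o v

  representative-cong : ∀ o {u v} → T (O o u v) → representative o u ≡ representative o v
  representative-cong o {u} {v} u~v
    with first (O o u) in eqᵤ | first (O o v) in eqᵥ | first-cong {p = O o u} {O o v} (λ w →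
      T-ext (IsEquivalence.trans (O-equivalence o) (IsEquivalence.sym (O-equivalence o) u~v))
            (IsEquivalence.trans (O-equivalence o) u~v))
  ... | just _  | just _  | refl = refl
  ... | nothing | _       | _ = ⊥-elim (first-complete (O o u) (~-refl o u) eqᵤ)
  ... | just _  | nothing | _ = ⊥-elim (first-complete (O o v) (~-refl o v) eqᵥ)

  word : FinPlay → List Position
  word init           = vι ∷ []
  word (extend ρ v _) = v ∷ word ρ

  infix 4 _≈[_]_

  _≈[_]_ : List Position → Obs → List Position → Set
  w ≈[ o ] w′ = Pointwise (λ u v → T (O o u v)) w w′

  ∼⇒≈ : ∀ {o ρ ρ′} → ρ ∼[ o ] ρ′ → word ρ ≈[ o ] word ρ′
  ∼⇒≈ {o} init         = ~-refl o vι ∷ []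
  ∼⇒≈     (extend r t) = t ∷ ∼⇒≈ r

  ≈⇒∼ : ∀ {o} ρ ρ′ → word ρ ≈[ o ] word ρ′ → ρ ∼[ o ] ρ′
  ≈⇒∼ init                      init                      _       = init
  ≈⇒∼ (extend ρ _ _)            (extend ρ′ _ _)           (t ∷ r) = extend (≈⇒∼ ρ ρ′ r) t
  ≈⇒∼ init                      (extend init _ _)         (_ ∷ ())
  ≈⇒∼ init                      (extend (extend _ _ _) _ _) (_ ∷ ())
  ≈⇒∼ (extend init _ _)         init                      (_ ∷ ())
  ≈⇒∼ (extend (extend _ _ _) _ _) init                    (_ ∷ ())

  label : Assignment → FinPlay → Label
  label χ ρ = Vec.map (Maybe.map (λ σ → σ ρ)) (agents χ) , Vec.map (Maybe.map (λ σ → σ ρ)) (vars χ)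

  Labels : Assignment → Tree → Set
  Labels χ t = ∀ ρ → t (word ρ) ≡ label χ ρ

  Observable : Formula → Tree → Set
  Observable φ t = ∀ {o x ψ} → (∃′[ o ] x ∙ ψ) ⊑ φ → ∀ {w w′} → w ≈[ o ] w′ → t w ≡ t w′

  Refining : Formula → Set
  Refining φ = ∀ {o₁ o₂ x y φ₁ φ₂} → (∃′[ o₂ ] x ∙ φ₂) ⊑ φ → (∃′[ o₁ ] y ∙ φ₁) ⊑ φ₂ →
               ∀ u v → T (O o₁ u v) → T (O o₂ u v)

  successor-complete : ∀ χ (c : Complete χ) ρ →
    successor (last ρ) (label χ ρ) ≡ just (E (last ρ) (jointAction χ c ρ))
  successor-complete χ c ρ = cong (Maybe.map (E (last ρ))) (all-just-complete (λ σ → σ ρ) (agents χ) c)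

  successor-defined : ∀ χ ρ {v} → successor (last ρ) (label χ ρ) ≡ just v → Complete χ
  successor-defined χ ρ eq with all-just (Vec.map (Maybe.map (λ σ → σ ρ)) (agents χ)) in eq′
  ... | just _ = all-just-defined (λ σ → σ ρ) (agents χ) eq′

  label-assign : ∀ χ x σ ρ → label (χ [var x ↦ σ ]) ρ ≡ assign x (σ ρ) (label χ ρ)
  label-assign χ x σ ρ = cong (_ ,_) (map-[]≔ (Maybe.map (λ σ → σ ρ)) (vars χ) x)

  label-bind : ∀ χ a x ρ → label (χ [agent a ↦var x ]) ρ ≡ bind a x (label χ ρ)
  label-bind χ a x ρ = cong (_, _) (trans (map-[]≔ f (agents χ) a)
    (cong (λ α → Vec.map f (agents χ) [ a ]≔ α) (sym (lookup-map x f (vars χ)))))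
    where
    f : Maybe Strategy → Maybe Action
    f = Maybe.map (λ σ → σ ρ)

  -- Correctness of the translation

  module Correctness (em : ∀ {P : Set} → Dec P) where
    open Acceptance em Label vι
    open Temporal successor

    quantify-correct : ∀ {n} (update : Fin n → Label → Label) o A {t v w} →
      (∀ {w w′} → w ≈[ o ] w′ → t w ≡ t w′) →
      Automaton.Recognises (quantify update (representative o) A) t v w ⇔
      (Σ[ σ ∈ (List Position → Fin n) ] (∀ {w w′} → w ≈[ o ] w′ → σ w ≡ σ w′) ×
        Automaton.Recognises A (λ w → update (σ w) (t w)) v w)
    quantify-correct {zero} update o A {t} _ = mk⇔
      (λ acc → ⊥-elim (to (atomic-correct (λ _ → false) t) acc))
      (λ (σ , _) → ⊥-elim (Fin.¬Fin0 (σ [])))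
    quantify-correct {suc n} update o A {t} uniform =
      Projection.project-correct em Label vι (finite-Fin (suc n)) zero update (λ u v → T (O o u v))
        (~-refl o) (representative o) (~-representative o) (representative-cong o) A t uniform

    -- Representatives of a play need not form a play, so strategies must be extended uniformly to
    -- all words. A word equivalent to a play inherits the value there, and all others share one
    -- default.
    module Extend {o σ} (σ-uniform : Uniform o σ) where
      Match : List Position → Set
      Match w = ∃[ ρ ] word ρ ≈[ o ] w

      value : ∀ {w} → Dec (Match w) → Action
      value (yes (ρ , _)) = σ ρ
      value (no _)        = σ init

      extended : List Position → Action
      extended w = value (em {Match w})

      ≈-sym : ∀ {w w′} → w ≈[ o ] w′ → w′ ≈[ o ] w
      ≈-sym = Pointwise.symmetric (IsEquivalence.sym (O-equivalence o))

      ≈-trans : ∀ {w w′ w″} → w ≈[ o ] w′ → w′ ≈[ o ] w″ → w ≈[ o ] w″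
      ≈-trans = Pointwise.transitive (IsEquivalence.trans (O-equivalence o))

      extended-uniform : ∀ {w w′} → w ≈[ o ] w′ → extended w ≡ extended w′
      extended-uniform {w} {w′} w≈w′ with em {Match w} | em {Match w′}
      ... | yes (ρ , m) | yes (ρ′ , m′) = σ-uniform (≈⇒∼ ρ ρ′ (≈-trans m (≈-trans w≈w′ (≈-sym m′))))
      ... | no _        | no _          = refl
      ... | yes (ρ , m) | no ¬m′        = ⊥-elim (¬m′ (ρ , ≈-trans m w≈w′))
      ... | no ¬m       | yes (ρ′ , m′) = ⊥-elim (¬m (ρ′ , ≈-trans m′ (≈-sym w≈w′)))

      extends : ∀ ρ → extended (word ρ) ≡ σ ρ
      extends ρ with em {Match (word ρ)}
      ... | yes (ρ′ , m) = σ-uniform (≈⇒∼ ρ′ ρ m)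
      ... | no ¬m        = ⊥-elim (¬m (ρ , Pointwise.refl (~-refl o _)))

    module Path (χ : Assignment) (t : Tree) (labels : Labels χ t) where

      successor-out : ∀ (c : Complete χ) ρ →
        successor (last ρ) (t (word ρ)) ≡ just (last (out χ c ρ 1))
      successor-out c ρ = trans (cong (successor (last ρ)) (labels ρ)) (successor-complete χ c ρ)

      defined : ∀ ρ {v} → successor (last ρ) (t (word ρ)) ≡ just v → Complete χ
      defined ρ eq = successor-defined χ ρ (trans (cong (successor (last ρ)) (sym (labels ρ))) eq)

      successor-unique : ∀ (c : Complete χ) ρ {v} → successor (last ρ) (t (word ρ)) ≡ just v →
                         v ≡ last (out χ c ρ 1)
      successor-unique c ρ eq with refl ← trans (sym eq) (successor-out c ρ) = refl

      module _ (c : Complete χ) (ρ : FinPlay) where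

        At : (Position → List Position → Set) → ℕ → Set
        At P n = P (last (out χ c ρ n)) (word (out χ c ρ n))

        until⁺ : ∀ P R d n → At R (d + n) → (∀ j → j < d + n → At P j) → At (Until t P R) n
        until⁺ P R zero    n r p = stop (successor-out c (out χ c ρ n)) r
        until⁺ P R (suc d) n r p = step (successor-out c (out χ c ρ n)) (p n (s≤s (m≤n+m n d)))
          (until⁺ P R d (suc n) (subst (At R) (sym (+-suc d n)) r)
            (λ j j< → p j (subst (j <_) (+-suc d n) j<)))

        until⁻ : ∀ P R n {v w} → Until t P R v w → v ≡ last (out χ c ρ n) → w ≡ word (out χ c ρ n) →
                 ∃[ i ] n ≤ i × At R i × (∀ j → n ≤ j → j < i → At P j)
        until⁻ P R n (stop _ r) refl refl = n , ≤-refl , r , λ j n≤j j<n → ⊥-elim (<-irrefl refl (≤-<-trans n≤j j<n))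
        until⁻ P R n (step eq p rest) refl refl
          with successor-unique c (out χ c ρ n) eq
        ... | refl with until⁻ P R (suc n) rest refl refl
        ...   | i , n<i , r , ps = i , <⇒≤ n<i , r , λ j n≤j j<i → by-cases j (m≤n⇒m<n∨m≡n n≤j) j<i
          where
          by-cases : ∀ j → n < j ⊎ n ≡ j → j < i → At P j
          by-cases j (inj₁ n<j)  j<i = ps j n<j j<i
          by-cases j (inj₂ refl) j<i = p

    correct : ∀ φ χ t → Labels χ t → Observable φ t → Refining φ → ∀ ρ →
              (χ , ρ ⊨ φ) ⇔ Automaton.Recognises (automaton φ) t (last ρ) (word ρ)
    correct (atom p) χ t labels obs ref ρ =
      mk⇔ (from (atomic-correct (λ v → ℓ v p) t)) (to (atomic-correct (λ v → ℓ v p) t))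
    correct (¬′ φ) χ t labels obs ref ρ = mk⇔
      (λ ¬s → from C (¬s ∘ from IH)) (λ acc → to C acc ∘ to IH)
      where
      IH = correct φ χ t labels (obs ∘ in-¬) (ref ∘ in-¬) ρ
      C = complement-correct (automaton φ) t
    correct (φ ∨′ ψ) χ t labels obs ref ρ = mk⇔
      (λ { (inj₁ s) → from C (inj₁ (to IH₁ s)) ; (inj₂ s) → from C (inj₂ (to IH₂ s)) })
      (λ acc → by-cases (to C acc))
      where
      IH₁ = correct φ χ t labels (obs ∘ in-∨ˡ) (ref ∘ in-∨ˡ) ρ
      IH₂ = correct ψ χ t labels (obs ∘ in-∨ʳ) (ref ∘ in-∨ʳ) ρ
      C = or-correct (automaton φ) (automaton ψ) t
      by-cases : _ ⊎ _ → _
      by-cases (inj₁ acc) = inj₁ (from IH₁ acc)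
      by-cases (inj₂ acc) = inj₂ (from IH₂ acc)
    correct (X′ φ) χ t labels obs ref ρ = mk⇔
      (λ (c , s) → from C (_ , successor-out c ρ , to (IH (out χ c ρ 1)) s))
      (λ acc → sound (to C acc))
      where
      open Path χ t labels
      IH = correct φ χ t labels (obs ∘ in-X) (ref ∘ in-X)
      C = next-correct (automaton φ) t
      sound : (∃[ v ] successor (last ρ) (t (word ρ)) ≡ just v ×
                Automaton.Recognises (automaton φ) t v (v ∷ word ρ)) → χ , ρ ⊨ X′ φ
      sound (v , eq , acc) with defined ρ eq
      ... | c with refl ← successor-unique c ρ eq = c , from (IH (out χ c ρ 1)) acc
    correct (φ U′ ψ) χ t labels obs ref ρ = mk⇔
      (λ (c , i , s , ss) → from C (until⁺ c ρ P R i 0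
        (subst (At c ρ R) (sym (+-identityʳ i)) (to (IH₂ (out χ c ρ i)) s))
        (λ j j< → to (IH₁ (out χ c ρ j)) (ss j (subst (j <_) (+-identityʳ i) j<)))))
      (λ acc → sound (to C acc))
      where
      open Path χ t labels
      IH₁ = correct φ χ t labels (obs ∘ in-Uˡ) (ref ∘ in-Uˡ)
      IH₂ = correct ψ χ t labels (obs ∘ in-Uʳ) (ref ∘ in-Uʳ)
      P = Automaton.Recognises (automaton φ) t
      R = Automaton.Recognises (automaton ψ) t
      C = until-correct (automaton φ) (automaton ψ) t
      -- Acceptance of an until exhibits a successor, and the label yields one only if all agents
      -- are bound.
      complete : ∀ {v w} → Until t P R v w → v ≡ last ρ → w ≡ word ρ → Complete χ
      complete (stop eq _)   refl refl = defined ρ eq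
      complete (step eq _ _) refl refl = defined ρ eq
      sound : Until t P R (last ρ) (word ρ) → χ , ρ ⊨ φ U′ ψ
      sound u = let c = complete u refl refl ; i , _ , r , ps = until⁻ c ρ P R 0 u refl refl in
        c , i , from (IH₂ (out χ c ρ i)) r , λ j j<i → from (IH₁ (out χ c ρ j)) (ps j z≤n j<i)
    correct (∃′[ o ] x ∙ φ) χ t labels obs ref ρ = mk⇔
      (λ (σ , uniform , s) → let open Extend {o} {σ} uniform in
        from C (extended , extended-uniform ,
          to (correct φ (χ [var x ↦ σ ]) (λ w → assign x (extended w) (t w)) (λ ρ → trans (cong₂ (assign x) (extends ρ) (labels ρ)) (sym (label-assign χ x σ ρ)))
               (observable extended-uniform) (ref ∘ in-∃) ρ) s))
      (λ acc → let σ , uniform , acc′ = to C acc in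
        σ ∘ word , (λ {ρ} {ρ′} r → uniform (∼⇒≈ r)) ,
        from (correct φ (χ [var x ↦ σ ∘ word ]) (λ w → assign x (σ w) (t w)) (λ ρ → trans (cong (assign x (σ (word ρ))) (labels ρ)) (sym (label-assign χ x (σ ∘ word) ρ)))
               (observable uniform) (ref ∘ in-∃) ρ) acc′)
      where
      C = quantify-correct (assign x) o (automaton φ) (obs here)
      observable : ∀ {σ : List Position → Action} → (∀ {w w′} → w ≈[ o ] w′ → σ w ≡ σ w′) →
                   Observable φ (λ w → assign x (σ w) (t w))
      observable uniform sub w≈w′ =
        -- The point where the hierarchy is used: `ref here sub` turns equivalence for the inner
        -- observation into equivalence for `o`, under which the new strategy is uniform.
        cong₂ (assign x) (uniform (Pointwise.map (ref here sub _ _) w≈w′)) (obs (in-∃ sub) w≈w′)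
    correct (⟨ a , x ⟩ φ) χ t labels obs ref ρ =
      correct φ (χ [agent a ↦var x ]) (bind a x ∘ t) (λ ρ → trans (cong (bind a x) (labels ρ)) (sym (label-bind χ a x ρ)))
        (λ sub w≈w′ → cong (bind a x) (obs (in-⟨⟩ sub) w≈w′)) (ref ∘ in-⟨⟩) ρ

    labels-∅ : Labels ∅ (λ _ → undefined)
    labels-∅ ρ = sym (cong₂ _,_ (map-replicate _ nothing nAg) (map-replicate _ nothing nVar))

theorem2 : DecidableOn Hierarchical Holds
theorem2 = (λ I → does (decision I)) , correctness
  where
  decision : ∀ I → Dec _
  decision I = Translation.decision (Instance.G I) (Instance.Φ I)
  does-true : ∀ {P : Set} (d : Dec P) → does d ≡ true ⇔ P
  does-true (yes p) = mk⇔ (λ _ → p) (λ _ → refl)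
  does-true (no ¬p) = mk⇔ (λ ()) (λ p → ⊥-elim (¬p p))
  correctness : _
  correctness em I hier = mk⇔
    (from holds ∘ from winning ∘ to (does-true (decision I)))
    (from (does-true (decision I)) ∘ to winning ∘ to holds)
    where
    open Instance I
    open Plays G
    open Translation G hiding (decision)
    open Correctness em
    -- The empty assignment gives a constant tree, which is uniform for every observation.
    holds = correct Φ ∅ (λ _ → undefined) labels-∅ (λ _ _ → refl) hier init
    winning = Decision.winning-correct Label (CGSi.vι G) (automaton Φ) undefined (CGSi.vι G) em
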